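{- Let $s,t\ge 3$ be integers, let $\varphi$ be a reflection of $C_t$, and let $G=C_s\Box^{\varphi}C_t$. Then $mbt(G)=4$ if $G$ is bipartite, and $mbt(G)=5$ otherwise.
   Context: The cycle $C_t$ has vertex set $\{1,\dots,t\}$ with $j$ adjacent to $j\pm 1$ (mod $t$). A reflection of $C_t$ is an automorphism of the form $j\mapsto c-j\pmod t$ for some integer $c$; it has exactly one fixed point if $t$ is odd, and either no or exactly two fixed points if $t$ is even. For an automorphism $\varphi$ of $C_t$, the Cartesian graph bundle $C_s\Box^{\varphi}C_t$ (fiber $C_t$ over base $C_s$, with $\varphi$ assigned to the base edge $\{s,1\}$ and the identity to all other base edges) is the graph with vertex set $\{(i,j):1\le i\le s,\ 1\le j\le t\}$ and edges: $(i,j)\sim(i,j+1)$ (second coordinate mod $t$) for all $i,j$; $(i,j)\sim(i+1,j)$ for $1\le i\le s-1$ and all $j$; and $(s,j)\sim(1,\varphi(j))$ for all $j$. A matching book embedding of a graph $G$ with $m$ pages consists of an arrangement of the vertices of $G$ in some cyclic order on a circle, with edges drawn as chords, together with a proper edge coloring with $m$ colors such that any two edges whose chords cross receive different colors. The matching book thickness $mbt(G)$ is the minimum $m$ for which such an embedding exists. -}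

module Defs where

open import Data.Nat using (ℕ; zero; suc; _+_; _*_; _∸_; _<_; _≤_)
open import Data.Fin using (Fin; toℕ)
open import Data.Bool using (Bool)
open import Data.Product using (Σ; ∃; _×_; _,_)
open import Data.Sum using (_⊎_)
open import Relation.Binary.PropositionalEquality using (_≡_; _≢_)
open import Relation.Nullary using (¬_)
open import Function.Definitions using (Injective)

-- Vertices of C_t are 0,…,t-1 (paper: 1,…,t); the shift is immaterial.

-- φ is a reflection of C_t: φ(j) ≡ c - j (mod t) for some c, i.e.
-- φ(j) + j ≡ c (mod t); since 0 ≤ φ(j)+j ≤ 2t-2 and we may take c ∈ {0,…,t-1},
-- this means φ(j) + j = c or φ(j) + j = c + t.
IsReflection : (t : ℕ) → (Fin t → Fin t) → Set
IsReflection t φ =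
  Σ (Fin t) λ c → ∀ j →
    (toℕ (φ j) + toℕ j ≡ toℕ c) ⊎ (toℕ (φ j) + toℕ j ≡ toℕ c + t)

-- Directed description of the edges of the bundle C_s □^φ C_t
-- (0-indexed: the base edge {s-1,0} carries φ).
data BundleArc (s t : ℕ) (φ : Fin t → Fin t) : Fin s × Fin t → Fin s × Fin t → Set where
  fiber : ∀ i j j' → toℕ j' ≡ suc (toℕ j) → BundleArc s t φ (i , j) (i , j')
  fiberWrap : ∀ i j j' → toℕ j ≡ t ∸ 1 → toℕ j' ≡ 0 → BundleArc s t φ (i , j) (i , j')
  base : ∀ i i' j → toℕ i' ≡ suc (toℕ i) → BundleArc s t φ (i , j) (i' , j)
  twist : ∀ i i' j → toℕ i ≡ s ∸ 1 → toℕ i' ≡ 0 → BundleArc s t φ (i , j) (i' , φ j)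

BundleAdj : (s t : ℕ) (φ : Fin t → Fin t) → Fin s × Fin t → Fin s × Fin t → Set
BundleAdj s t φ u v = BundleArc s t φ u v ⊎ BundleArc s t φ v u

Bipartite : (V : Set) → (V → V → Set) → Set
Bipartite V Adj = Σ (V → Bool) λ f → ∀ u v → Adj u v → f u ≢ f v

-- A matching book embedding with m pages of the graph (V, Adj).
-- The cyclic order on the circle is given by an injective position map
-- pos : V → ℕ (read cyclically).  Edge {u,v} gets colour col u v (= col v u).
-- Chords {a,b} and {c,d} cross iff their endpoints interleave:
-- pos a < pos c < pos b < pos d (all labellings are quantified over).
record MatchingBookEmbedding (V : Set) (Adj : V → V → Set) (m : ℕ) : Set where
  field
    pos       : V → ℕ
    pos-inj   : Injective _≡_ _≡_ pos
    col       : V → V → Fin m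
    col-sym   : ∀ u v → Adj u v → col u v ≡ col v u
    proper    : ∀ u v w → Adj u v → Adj u w → v ≢ w → col u v ≢ col u w
    noCross   : ∀ a b c d → Adj a b → Adj c d →
                pos a < pos c → pos c < pos b → pos b < pos d →
                col a b ≢ col c d

HasMBT : (V : Set) → (V → V → Set) → ℕ → Set
HasMBT V Adj k =
  MatchingBookEmbedding V Adj k × (∀ m → m < k → ¬ MatchingBookEmbedding V Adj m)

{-# OPTIONS --safe #-}
module Submission where

-- Lower bounds: the graph is 4-regular, so at least four pages are needed.  With exactly four, every
-- page is a perfect noncrossing matching; the vertices under an edge are matched among themselves,
-- so the ends of an edge have positions of opposite parity and the graph is bipartite.
-- Upper bounds: rotating the fibre, the reflection j ↦ c-j becomes j ↦ -j or j ↦ -1-j (mod t).  The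
-- graph is bipartite iff t and s + c are even, and each layout below traverses blocks of vertices alternately
-- forwards and backwards, so that the edges between consecutive blocks are nested.  For odd s the
-- blocks are the fibres, since then also the edges over the twisted base edge are nested; for
-- even s they are formed by the vertices over the orbits {j , φ j} of the reflection.

open import Defs
open import Data.Nat using (ℕ; _≤_)
open import Data.Fin using (Fin)
open import Data.Product using (_×_)
open import Relation.Nullary using (¬_)

open import Algebra.Bundles using (CommutativeRing)
import Algebra.Properties.CommutativeMonoid.Sum as Sum
open import Data.Bool using (Bool; true; false; not; if_then_else_; _xor_; _∧_)
open import Data.Bool.Properties using (not-injective; not-¬; ¬-not; not-involutive;
  not-distribˡ-xor; not-distribʳ-xor; xor-same; xor-comm; xor-identityʳ; xor-∧-commutativeRing)
open import Data.Empty using (⊥)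
open import Data.Fin as Fin using (toℕ)
open import Data.Fin.Induction using (<-weakInduction)
open import Data.Fin.Patterns using (0F; 1F; 2F; 3F; 4F; 5F)
open import Data.Fin.Permutation using (permutation)
import Data.Fin.Properties as Fin
open import Data.Nat hiding (ℕ; _≤_)
open import Data.Nat.DivMod
open import Data.Nat.Properties
open import Data.Nat.Tactic.RingSolver using (solve-∀)
open import Data.Product using (∃; _,_; proj₁; proj₂)
open import Data.Product.Properties using (×-≡,≡→≡; ≡-dec)
open import Data.Sum using (_⊎_; inj₁; inj₂; [_,_]′; swap)
open import Data.Unit using (⊤)
open import Function using (_∘_; _↔_; Inverse; mk⇔)
open import Function.Definitions using (Injective)
open import Function.Properties.Inverse using (↔-sym)
open import Relation.Binary using (tri<; tri≈; tri>; DecidableEquality)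
open import Relation.Binary.PropositionalEquality
open import Relation.Nullary using (yes; no; Dec; contradiction; ¬?; does)
open import Relation.Nullary.Decidable using (True; toWitness; dec-true; dec-false; does-⇔; _×-dec_; _⊎-dec_)

-- Noncrossing chords and boustrophedon numberings

-- Throughout, `S` and `T` are `s - 1` and `t - 1`, so `odd S ≡ false` is the case of odd `s`; the
-- endings `Odd` and `Even` of the layout modules refer to `s`. The obstacle in every layout is to
-- close up the base cycle. Blocks that run alternately forwards and backwards nest the edges
-- between neighbouring blocks, but with fibres as blocks the reversal in the twist also requires
-- the first and the last fibre to run the same way, which fails for even `s`. Grouping by orbits
-- avoids this, because every base edge, twisted or not, then stays inside one block. An edge
-- between consecutive positions crosses nothing, so its colour only has to be proper; the pages are
-- spent on the remaining edges. With four pages every colour occurs at every vertex, so that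
-- properness alone often dictates the choice of colours.

odd : ℕ → Bool
odd zero    = false
odd (suc n) = not (odd n)

odd-+ : ∀ m n → odd (m + n) ≡ odd m xor odd n
odd-+ zero    n = refl
odd-+ (suc m) n = trans (cong not (odd-+ m n)) (not-distribˡ-xor (odd m) (odd n))

odd-halve : ∀ n → odd n ≡ false → ∃ λ k → n ≡ k + k
odd-halve zero          _ = 0 , refl
odd-halve (suc (suc n)) p with odd-halve n (trans (sym (not-involutive _)) p)
... | k , refl = suc k , cong suc (sym (+-suc k k))

same-parity-suc : ∀ n → odd n ≢ odd (suc n)
same-parity-suc n = not-¬ refl

Within : ℕ → ℕ → ℕ → Set
Within p q r = (p < r × r < q) ⊎ (q < r × r < p)

-- Chords {p,q} and {r,z} cross iff each has an end strictly inside the other; this form of the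
-- interleaving condition does not depend on the labelling of the ends.
Stabs : ℕ → ℕ → ℕ → ℕ → Set
Stabs p q r z = Within p q r ⊎ Within p q z

NonCrossing : ℕ → ℕ → ℕ → ℕ → Set
NonCrossing p q r z = Stabs p q r z → Stabs r z p q → ⊥

private variable
  p q r z : ℕ

Within-sym : Within p q r → Within q p r
Within-sym (inj₁ x) = inj₂ x
Within-sym (inj₂ x) = inj₁ x

Stabs-symˡ : Stabs p q r z → Stabs q p r z
Stabs-symˡ (inj₁ x) = inj₁ (Within-sym x)
Stabs-symˡ (inj₂ x) = inj₂ (Within-sym x)

Stabs-symʳ : Stabs p q r z → Stabs p q z r
Stabs-symʳ (inj₁ x) = inj₂ x
Stabs-symʳ (inj₂ x) = inj₁ x

nc-swap : NonCrossing p q r z → NonCrossing r z p q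
nc-swap n s t = n t s

nc-flipˡ : NonCrossing p q r z → NonCrossing q p r z
nc-flipˡ n s t = n (Stabs-symˡ s) (Stabs-symʳ t)

nc-flipʳ : NonCrossing p q r z → NonCrossing p q z r
nc-flipʳ n s t = n (Stabs-symʳ s) (Stabs-symˡ t)

nc-short : q ≡ suc p → NonCrossing p q r z
nc-short {p = p} refl s _ = [ nope , nope ]′ s
  where
  nope : ∀ {r} → ¬ Within p (suc p) r
  nope (inj₁ (a , b)) = <⇒≱ b a
  nope (inj₂ (a , b)) = <-asym a (<-trans b (n<1+n _))

-- Equal sums mean equal midpoints, so the chords are concentric. With `refl` it also compares a
-- chord with itself.
nc-sum : p + q ≡ r + z → NonCrossing p q r z
nc-sum {p} {q} {r} {z} e (inj₁ a) t = outer e a t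
  where
  core : ∀ {p q r z} → p + q ≡ r + z → p < r → r < q → ¬ Stabs r z p q
  core e a b (inj₁ (inj₁ (c , d))) = <-asym a c
  core {p} {q} {r} {z} e a b (inj₁ (inj₂ (c , d))) = <-irrefl (trans (+-comm z r) (sym e)) (+-mono-< c b)
  core e a b (inj₂ (inj₁ (c , d))) = <-irrefl e (+-mono-< a d)
  core e a b (inj₂ (inj₂ (c , d))) = <-asym b d
  outer : ∀ {p q r z} → p + q ≡ r + z → Within p q r → ¬ Stabs r z p q
  outer e (inj₁ (a , b)) t = core e a b t
  outer {p} {q} e (inj₂ (a , b)) t = core (trans (+-comm q p) e) a b (Stabs-symʳ t)
nc-sum {p} {q} {r} {z} e (inj₂ a) t = nc-sum (trans e (+-comm r z)) (inj₁ a) (Stabs-symˡ t)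

Beyond : ℕ → ℕ → ℕ → Set
Beyond p r z = (p < r × p < z) ⊎ (r < p × z < p)

nc-beyond : Beyond p r z → Beyond q r z → NonCrossing p q r z
nc-beyond u v _ t = [ nope u , nope v ]′ t
  where
  nope : ∀ {p r z} → Beyond p r z → ¬ Within r z p
  nope (inj₁ (a , b)) (inj₁ (c , d)) = <-asym a c
  nope (inj₁ (a , b)) (inj₂ (c , d)) = <-asym b c
  nope (inj₂ (a , b)) (inj₁ (c , d)) = <-asym b d
  nope (inj₂ (a , b)) (inj₂ (c , d)) = <-asym a d

flip : Bool → ℕ → ℕ → ℕ
flip false w o = o
flip true  w o = w ∸ o

flip-≤ : ∀ b {w o} → o ≤ w → flip b w o ≤ w
flip-≤ false     o≤w = o≤w
flip-≤ true  {w} {o} _   = m∸n≤m w o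

-- Boustrophedon numbering: blocks of size w + 1, traversed in alternating directions.
snake : ℕ → ℕ → ℕ → ℕ
snake w b o = b * suc w + flip (odd b) w o

module _ {w : ℕ} where

  snake-< : ∀ {b b' o o'} → b < b' → o ≤ w → snake w b o < snake w b' o'
  snake-< {b} {b'} {o} {o'} b<b' o≤w = begin-strict
    b * suc w + flip (odd b) w o   <⟨ +-monoʳ-< (b * suc w) (s≤s (flip-≤ (odd b) o≤w)) ⟩
    b * suc w + suc w              ≡⟨ +-comm (b * suc w) (suc w) ⟩
    suc b * suc w                  ≤⟨ *-monoˡ-≤ (suc w) b<b' ⟩
    b' * suc w                     ≤⟨ m≤m+n _ _ ⟩
    snake w b' o'                  ∎
    where open ≤-Reasoning

  snake-injective : ∀ {b b' o o'} → o ≤ w → o' ≤ w → snake w b o ≡ snake w b' o' → b ≡ b' × o ≡ o'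
  snake-injective {b} {b'} o≤w o'≤w e with <-cmp b b'
  ... | tri< b<b' _ _ = contradiction e (<⇒≢ (snake-< b<b' o≤w))
  ... | tri> _ _ b'<b = contradiction (sym e) (<⇒≢ (snake-< b'<b o'≤w))
  ... | tri≈ _ refl _ = refl , cancel (odd b) (+-cancelˡ-≡ (b * suc w) _ _ e)
    where
    cancel : ∀ x → flip x w _ ≡ flip x w _ → _ ≡ _
    cancel false e = e
    cancel true  e = ∸-cancelˡ-≡ o≤w o'≤w e

  snake-beyond : ∀ {b c c' x y y'} → x ≤ w → y ≤ w → y' ≤ w → Beyond b c c' →
                 Beyond (snake w b x) (snake w c y) (snake w c' y')
  snake-beyond x≤ y≤ y'≤ (inj₁ (u , v)) = inj₁ (snake-< u x≤ , snake-< v x≤)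
  snake-beyond x≤ y≤ y'≤ (inj₂ (u , v)) = inj₂ (snake-< u y≤ , snake-< v y'≤)

  nc-blocks : ∀ {b b' c c' x x' y y'} → x ≤ w → x' ≤ w → y ≤ w → y' ≤ w →
              Beyond b c c' → Beyond b' c c' →
              NonCrossing (snake w b x) (snake w b' x') (snake w c y) (snake w c' y')
  nc-blocks x≤ x'≤ y≤ y'≤ u v =
    nc-beyond (snake-beyond x≤ y≤ y'≤ u) (snake-beyond x'≤ y≤ y'≤ v)

  nc-far : ∀ b c {x x' y y'} → x ≤ w → x' ≤ w → y ≤ w → y' ≤ w → suc b < c →
           NonCrossing (snake w b x) (snake w (suc b) x') (snake w c y) (snake w (suc c) y')
  nc-far b c x≤ x'≤ y≤ y'≤ lt =
    nc-blocks x≤ x'≤ y≤ y'≤ (inj₁ (b<c , m≤n⇒m≤1+n b<c)) (inj₁ (lt , m≤n⇒m≤1+n lt))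
    where b<c = <-trans (n<1+n b) lt

  Within-snake : ∀ b {x y v} → Within (snake w b x) (snake w b y) (snake w b v) → Within x y v
  Within-snake b = go (odd b)
    where
    go : ∀ o {x y v} → Within (b * suc w + flip o w x) (b * suc w + flip o w y) (b * suc w + flip o w v) → Within x y v
    go false (inj₁ (s , t)) = inj₁ (+-cancelˡ-< (b * suc w) _ _ s , +-cancelˡ-< (b * suc w) _ _ t)
    go false (inj₂ (s , t)) = inj₂ (+-cancelˡ-< (b * suc w) _ _ s , +-cancelˡ-< (b * suc w) _ _ t)
    go true {x} {y} {v} (inj₁ (s , t)) =
      inj₂ (∸-cancelʳ-< {v} {y} {w} (+-cancelˡ-< (b * suc w) _ _ t)
           , ∸-cancelʳ-< {x} {v} {w} (+-cancelˡ-< (b * suc w) _ _ s))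
    go true {x} {y} {v} (inj₂ (s , t)) =
      inj₁ (∸-cancelʳ-< {v} {x} {w} (+-cancelˡ-< (b * suc w) _ _ t)
           , ∸-cancelʳ-< {y} {v} {w} (+-cancelˡ-< (b * suc w) _ _ s))

  -- Inside one block positions rise or fall with the offset, so they interleave only if the offsets
  -- do. The offsets may themselves be positions in a smaller snake, as in `FivePageEven`.
  nc-snake : ∀ b {x y u v} → NonCrossing x y u v →
             NonCrossing (snake w b x) (snake w b y) (snake w b u) (snake w b v)
  nc-snake b n s t = n (stabs s) (stabs t)
    where
    stabs : ∀ {x y u v} → Stabs (snake w b x) (snake w b y) (snake w b u) (snake w b v) → Stabs x y u v
    stabs (inj₁ a) = inj₁ (Within-snake b a)
    stabs (inj₂ a) = inj₂ (Within-snake b a)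

  nc-step : ∀ b {o} → suc o ≤ w → NonCrossing (snake w b o) (snake w b (suc o)) r z
  nc-step b {o} o<w = go (odd b)
    where
    go : ∀ x → NonCrossing (b * suc w + flip x w o) (b * suc w + flip x w (suc o)) r z
    go false = nc-short (+-suc (b * suc w) o)
    go true  = nc-flipˡ (nc-short (trans (cong (b * suc w +_) (+-∸-assoc 1 o<w)) (+-suc _ _)))

  -- Consecutive blocks run in opposite directions, so up to a constant the sum of the positions is
  -- `x - y` or `y - x`. The hypothesis is `x - y = x' - y'` without subtraction; it covers edges
  -- between equal offsets and edges shifted by a fixed amount.
  snake-sum : ∀ b {x y x' y'} → x ≤ w → y ≤ w → x' ≤ w → y' ≤ w → x + y' ≡ x' + y →
              snake w b x + snake w (suc b) y ≡ snake w b x' + snake w (suc b) y'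
  snake-sum b {x} {y} {x'} {y'} x≤ y≤ x'≤ y'≤ e = begin
    snake w b x + snake w (suc b) y     ≡⟨ shuffle (b * suc w) (suc b * suc w) _ _ ⟩
    K + (flip (odd b) w x + flip (not (odd b)) w y)   ≡⟨ cong (K +_) (go (odd b)) ⟩
    K + (flip (odd b) w x' + flip (not (odd b)) w y') ≡⟨ shuffle (b * suc w) (suc b * suc w) _ _ ⟨
    snake w b x' + snake w (suc b) y'   ∎
    where
    open ≡-Reasoning
    K = b * suc w + suc b * suc w
    shuffle : ∀ k l m n → (k + m) + (l + n) ≡ (k + l) + (m + n)
    shuffle = solve-∀
    mirror : ∀ {x y x' y'} → y ≤ w → y' ≤ w → x + y' ≡ x' + y → x + (w ∸ y) ≡ x' + (w ∸ y')
    mirror {x} {y} {x'} {y'} y≤ y'≤ e = +-cancelʳ-≡ (y + y') _ _ (begin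
      x + (w ∸ y) + (y + y')     ≡⟨ cong (x + (w ∸ y) +_) (+-comm y y') ⟩
      x + (w ∸ y) + (y' + y)     ≡⟨ shuffle x y' (w ∸ y) y ⟩
      (x + y') + (w ∸ y + y)  ≡⟨ cong (x + y' +_) (m∸n+n≡m y≤) ⟩
      (x + y') + w            ≡⟨ cong (_+ w) e ⟩
      (x' + y) + w            ≡⟨ cong (x' + y +_) (m∸n+n≡m y'≤) ⟨
      (x' + y) + (w ∸ y' + y')  ≡⟨ shuffle x' y (w ∸ y') y' ⟨
      x' + (w ∸ y') + (y + y') ∎)
    go : ∀ o → flip o w x + flip (not o) w y ≡ flip o w x' + flip (not o) w y'
    go false = mirror y≤ y'≤ e
    go true  = begin
      (w ∸ x) + y    ≡⟨ +-comm (w ∸ x) y ⟩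
      y + (w ∸ x)    ≡⟨ mirror {y} {x} {y'} {x'} x≤ x'≤ (trans (+-comm y x') (trans (sym e) (+-comm x y'))) ⟩
      y' + (w ∸ x')  ≡⟨ +-comm y' (w ∸ x') ⟩
      (w ∸ x') + y'  ∎

  nc-adjacent : ∀ b {x y x' y'} → x ≤ w → y ≤ w → x' ≤ w → y' ≤ w → x + y' ≡ x' + y →
                NonCrossing (snake w b x) (snake w (suc b) y) (snake w b x') (snake w (suc b) y')
  nc-adjacent b x≤ y≤ x'≤ y'≤ e = nc-sum (snake-sum b x≤ y≤ x'≤ y'≤ e)

  snake-even : ∀ {b o} → odd b ≡ false → snake w b o ≡ b * suc w + o
  snake-even e rewrite e = refl

-- Distinct numbers of equal parity differ by at least 2, so the pairs of blocks `i`, `suc i` and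
-- `i'`, `suc i'` are disjoint. Hence two alternating colours can serve the edges between
-- consecutive blocks.
parity-gap : ∀ {i i'} → odd i ≡ odd i' → i ≢ i' → suc i < i' ⊎ suc i' < i
parity-gap {i} {i'} e ne with <-cmp i i'
... | tri≈ _ x _ = contradiction x ne
... | tri< i<i' _ _ = inj₁ (≤∧≢⇒< i<i' λ { refl → same-parity-suc i e })
... | tri> _ _ i'<i = inj₂ (≤∧≢⇒< i'<i λ { refl → same-parity-suc i' (sym e) })

-- From layouts of the bundle to book embeddings

-- A layout names the points by their role under the reflection, in a type that may be infinite;
-- `Valid` cuts out the actual fibre.
record Fibre : Set₁ where
  infix 4 _↝_ _⋈_
  field
    Point : Set
    Valid : Point → Set
    _↝_   : Point → Point → Set
    _⋈_   : Point → Point → Set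

-- The bundle over a cycle 0, …, S, where p ↝ q are the fibre arcs and p ⋈ q says that
-- (S , p) is joined to (0 , q).
module Bundle (G : Fibre) (S : ℕ) where
  open Fibre G

  data Link : ℕ → Point → ℕ → Point → Set where
    level : ∀ {i p} → suc i ≤ S → Valid p → Link i p (suc i) p
    twist : ∀ {p q} → p ⋈ q → Link S p 0 q

  data Arc : ℕ → Point → ℕ → Point → Set where
    fibre : ∀ {i p q} → i ≤ S → p ↝ q → Arc i p i q
    base  : ∀ {i p i' q} → Link i p i' q → Arc i p i' q

  colour : ∀ {m i p i' q} (colF colB : ℕ → Point → Fin m) → Arc i p i' q → Fin m
  colour {i = i} {p} colF _ (fibre _ _) = colF i p
  colour {i = i} {p} _ colB (base _)    = colB i p

-- colF i p and colB i p are the colours of the fibre arc and of the base arc leaving (i , p).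
record Layout (G : Fibre) (S m : ℕ) : Set where
  open Fibre G
  open Bundle G S
  field
    pos       : ℕ → Point → ℕ
    colF colB : ℕ → Point → Fin m

    pos-injective : ∀ {i i' p q} → i ≤ S → i' ≤ S → Valid p → Valid q →
                    pos i p ≡ pos i' q → i ≡ i' × p ≡ q
    -- A vertex has a fibre arc and a base arc in each direction. These six fields separate the six
    -- pairs among the four; a prime marks that the fibre arc is the one entering the vertex instead
    -- of the one leaving it.
    ff   : ∀ {i p q} → i ≤ S → p ↝ q → colF i p ≢ colF i q
    fb   : ∀ {i p} → i ≤ S → Valid p → colF i p ≢ colB i p
    fb′  : ∀ {i p q} → i ≤ S → p ↝ q → colF i p ≢ colB i q
    bb   : ∀ {i p i' q} → Link i p i' q → colB i p ≢ colB i' q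
    bf   : ∀ {i p i' q} → Link i p i' q → colB i p ≢ colF i' q
    bf′  : ∀ {i p i' q r} → Link i p i' q → r ↝ q → colB i p ≢ colF i' r
    nc   : ∀ {i p i' q k r k' z} (e : Arc i p i' q) (f : Arc k r k' z) → colour colF colB e ≡ colour colF colB f →
           NonCrossing (pos i p) (pos i' q) (pos k r) (pos k' z)

record Coordinates (T : ℕ) (φ : Fin (suc T) → Fin (suc T)) (G : Fibre) : Set where
  open Fibre G
  field
    ι           : Fin (suc T) → Point
    ι-injective : Injective _≡_ _≡_ ι
    ι-valid     : ∀ j → Valid (ι j)
    ι-step      : ∀ {j j'} → toℕ j' ≡ suc (toℕ j) → ι j ↝ ι j'
    ι-wrap      : ∀ {j j'} → toℕ j ≡ T → toℕ j' ≡ 0 → ι j ↝ ι j'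
    ι-twist     : ∀ j → ι j ⋈ ι (φ j)

module Embed {S T : ℕ} (2≤S : 2 ≤ S) (2≤T : 2 ≤ T)
             (φ : Fin (suc T) → Fin (suc T)) (φ-injective : Injective _≡_ _≡_ φ) where

  V : Set
  V = Fin (suc S) × Fin (suc T)

  Adj : V → V → Set
  Adj = BundleAdj (suc S) (suc T) φ

  NextF : Fin (suc T) → Fin (suc T) → Set
  NextF j j' = toℕ j' ≡ suc (toℕ j) ⊎ (toℕ j ≡ T × toℕ j' ≡ 0)

  NextB : V → V → Set
  NextB (i , j) (i' , j') = (toℕ i' ≡ suc (toℕ i) × j' ≡ j) ⊎ (toℕ i ≡ S × toℕ i' ≡ 0 × j' ≡ φ j)

  Next : V → V → Set
  Next (i , j) (i' , j') = (i' ≡ i × NextF j j') ⊎ NextB (i , j) (i' , j')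

  -- `col` is applied to two vertices without a proof of adjacency, so `edgeCol` has to decide
  -- whether an arc leads from the first to the second.
  next? : ∀ u v → Dec (Next u v)
  next? (i , j) (i' , j') =
    ((i' Fin.≟ i) ×-dec ((toℕ j' ≟ suc (toℕ j)) ⊎-dec ((toℕ j ≟ T) ×-dec (toℕ j' ≟ 0))))
    ⊎-dec (((toℕ i' ≟ suc (toℕ i)) ×-dec (j' Fin.≟ j))
           ⊎-dec ((toℕ i ≟ S) ×-dec ((toℕ i' ≟ 0) ×-dec (j' Fin.≟ φ j))))

  arc→next : ∀ {u v} → BundleArc (suc S) (suc T) φ u v → Next u v
  arc→next (fiber i j j' e)       = inj₁ (refl , inj₁ e)
  arc→next (fiberWrap i j j' e f) = inj₁ (refl , inj₂ (e , f))
  arc→next (base i i' j e)        = inj₂ (inj₁ (e , refl))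
  arc→next (twist i i' j e f)     = inj₂ (inj₂ (e , f , refl))

  bounded : ∀ {n} (j : Fin (suc n)) → ¬ (toℕ j ≡ suc n)
  bounded j e = <⇒≢ (Fin.toℕ<n j) e

  NextF-functional : ∀ {j k k'} → NextF j k → NextF j k' → k ≡ k'
  NextF-functional (inj₁ e) (inj₁ f) = Fin.toℕ-injective (trans e (sym f))
  NextF-functional {j} {k} (inj₁ e) (inj₂ (f , _)) = contradiction (trans e (cong suc f)) (bounded k)
  NextF-functional {j} {k} {k'} (inj₂ (f , _)) (inj₁ e) = contradiction (trans e (cong suc f)) (bounded k')
  NextF-functional (inj₂ (_ , e)) (inj₂ (_ , f)) = Fin.toℕ-injective (trans e (sym f))

  NextF-injective : ∀ {j k k'} → NextF k j → NextF k' j → k ≡ k'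
  NextF-injective (inj₁ e) (inj₁ f) = Fin.toℕ-injective (suc-injective (trans (sym e) f))
  NextF-injective (inj₁ e) (inj₂ (_ , f)) = contradiction (trans (sym f) e) λ ()
  NextF-injective (inj₂ (_ , f)) (inj₁ e) = contradiction (trans (sym f) e) λ ()
  NextF-injective (inj₂ (e , _)) (inj₂ (f , _)) = Fin.toℕ-injective (trans e (sym f))

  NextB-functional : ∀ {u v w} → NextB u v → NextB u w → v ≡ w
  NextB-functional (inj₁ (e , p)) (inj₁ (f , q)) = ×-≡,≡→≡ (Fin.toℕ-injective (trans e (sym f)) , trans p (sym q))
  NextB-functional {u} {v} (inj₁ (e , _)) (inj₂ (f , _)) = contradiction (trans e (cong suc f)) (bounded (proj₁ v))
  NextB-functional {u} {v} {w} (inj₂ (f , _)) (inj₁ (e , _)) = contradiction (trans e (cong suc f)) (bounded (proj₁ w))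
  NextB-functional (inj₂ (_ , e , p)) (inj₂ (_ , f , q)) = ×-≡,≡→≡ (Fin.toℕ-injective (trans e (sym f)) , trans p (sym q))

  NextB-injective : ∀ {u v w} → NextB v u → NextB w u → v ≡ w
  NextB-injective (inj₁ (e , p)) (inj₁ (f , q)) =
    ×-≡,≡→≡ (Fin.toℕ-injective (suc-injective (trans (sym e) f)) , trans (sym p) q)
  NextB-injective (inj₁ (e , _)) (inj₂ (_ , f , _)) = contradiction (trans (sym f) e) λ ()
  NextB-injective (inj₂ (_ , f , _)) (inj₁ (e , _)) = contradiction (trans (sym f) e) λ ()
  NextB-injective (inj₂ (e , _ , p)) (inj₂ (f , _ , q)) =
    ×-≡,≡→≡ (Fin.toℕ-injective (trans e (sym f)) , φ-injective (trans (sym p) q))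

  private
    -- Here `n` is the last index of a cycle. With at least three vertices no arc has a reverse, so
    -- every edge has one direction and `edgeCol` is symmetric; on a cycle of length 2 this would
    -- fail.
    no-backstep : ∀ {a b n} → 2 ≤ n → (b ≡ suc a ⊎ (a ≡ n × b ≡ 0)) → ¬ (a ≡ suc b ⊎ (b ≡ n × a ≡ 0))
    no-backstep _ (inj₁ refl) (inj₁ ())
    no-backstep (s≤s ()) (inj₁ refl) (inj₂ (refl , refl))
    no-backstep (s≤s ()) (inj₂ (refl , refl)) (inj₁ refl)

    forget : ∀ {u v} → NextB u v → toℕ (proj₁ v) ≡ suc (toℕ (proj₁ u)) ⊎ (toℕ (proj₁ u) ≡ S × toℕ (proj₁ v) ≡ 0)
    forget (inj₁ (e , _))     = inj₁ e
    forget (inj₂ (e , f , _)) = inj₂ (e , f)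

  NextB-moves : ∀ {u v} → NextB u v → proj₁ v ≢ proj₁ u
  NextB-moves b refl = no-backstep 2≤S (forget b) (forget b)

  next-asym : ∀ {u v} → Next u v → ¬ Next v u
  next-asym (inj₁ (_ , f)) (inj₁ (_ , g)) = no-backstep 2≤T f g
  next-asym (inj₁ (e , _)) (inj₂ b)       = NextB-moves b (sym e)
  next-asym (inj₂ b)       (inj₁ (e , _)) = NextB-moves b (sym e)
  next-asym (inj₂ b)       (inj₂ c)       = no-backstep 2≤S (forget b) (forget c)

  module _ {m : ℕ} {G : Fibre} (L : Layout G S m) (C : Coordinates T φ G) where
    open Fibre G
    open Bundle G S
    open Layout L
    open Coordinates C

    place : V → ℕ
    place (i , j) = pos (toℕ i) (ι j)

    outF outB : V → Fin m
    outF (i , j) = colF (toℕ i) (ι j)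
    outB (i , j) = colB (toℕ i) (ι j)

    nextF→↝ : ∀ {j j'} → NextF j j' → ι j ↝ ι j'
    nextF→↝ (inj₁ e)       = ι-step e
    nextF→↝ (inj₂ (e , f)) = ι-wrap e f

    nextB→link : ∀ {i j i' j'} → NextB (i , j) (i' , j') → Link (toℕ i) (ι j) (toℕ i') (ι j')
    nextB→link {i} {j} {i'} (inj₁ (e , refl)) =
      subst (λ k → Link (toℕ i) (ι j) k (ι j)) (sym e)
        (level (subst (_≤ S) e (Fin.toℕ≤pred[n] i')) (ι-valid j))
    nextB→link {i} {j} {i'} (inj₂ (e , f , refl)) =
      subst₂ (λ k l → Link k (ι j) l (ι (φ j))) (sym e) (sym f) (twist (ι-twist j))

    outCol : V → V → Fin m
    outCol (i , j) (i' , j') with i' Fin.≟ i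
    ... | yes _ = outF (i , j)
    ... | no  _ = outB (i , j)

    outCol-F : ∀ u v → proj₁ v ≡ proj₁ u → outCol u v ≡ outF u
    outCol-F (i , _) (i' , _) e with i' Fin.≟ i
    ... | yes _ = refl
    ... | no ne = contradiction e ne

    outCol-B : ∀ u v → proj₁ v ≢ proj₁ u → outCol u v ≡ outB u
    outCol-B (i , _) (i' , _) ne with i' Fin.≟ i
    ... | yes e = contradiction e ne
    ... | no _  = refl

    edgeCol : V → V → Fin m
    edgeCol u v with next? u v
    ... | yes _ = outCol u v
    ... | no  _ = outCol v u

    data Role (u v : V) : Fin m → Set where
      toF   : proj₁ v ≡ proj₁ u → NextF (proj₂ u) (proj₂ v) → Role u v (outF u)
      fromF : proj₁ u ≡ proj₁ v → NextF (proj₂ v) (proj₂ u) → Role u v (outF v)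
      toB   : NextB u v → Role u v (outB u)
      fromB : NextB v u → Role u v (outB v)

    role : ∀ {u v} → Adj u v → Role u v (edgeCol u v)
    role {u} {v} a with next? u v | a
    ... | yes (inj₁ (e , f)) | _ = subst (Role u v) (sym (outCol-F u v e)) (toF e f)
    ... | yes (inj₂ b)       | _ = subst (Role u v) (sym (outCol-B u v (NextB-moves b))) (toB b)
    ... | no ¬n | inj₁ x = contradiction (arc→next x) ¬n
    ... | no _  | inj₂ x with arc→next x
    ...   | inj₁ (e , f) = subst (Role u v) (sym (outCol-F v u e)) (fromF e f)
    ...   | inj₂ b       = subst (Role u v) (sym (outCol-B v u (NextB-moves b))) (fromB b)

    edgeCol-sym : ∀ u v → Adj u v → edgeCol u v ≡ edgeCol v u
    edgeCol-sym u v a with next? u v | next? v u | a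
    ... | yes x | yes y | _      = contradiction y (next-asym x)
    ... | yes _ | no _  | _      = refl
    ... | no _  | yes _ | _      = refl
    ... | no x  | no y  | inj₁ e = contradiction (arc→next e) x
    ... | no x  | no y  | inj₂ e = contradiction (arc→next e) y

    -- Equal roles force `v ≡ w`, as successors and predecessors along fibre and base are unique;
    -- distinct roles are the six colour conditions of `Layout`, each in both orders.
    role-proper : ∀ {u v w x y} → Role u v x → Role u w y → v ≢ w → x ≢ y
    role-proper (toF e f) (toF e' f') ne = contradiction (×-≡,≡→≡ (trans e (sym e') , NextF-functional f f')) ne
    role-proper (fromF e f) (fromF e' f') ne = contradiction (×-≡,≡→≡ (trans (sym e) e' , NextF-injective f f')) ne
    role-proper (toB b) (toB b') ne = contradiction (NextB-functional b b') ne
    role-proper (fromB b) (fromB b') ne = contradiction (NextB-injective b b') ne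
    role-proper {u} (toF _ f) (fromF refl f') _ = ≢-sym (ff (Fin.toℕ≤pred[n] (proj₁ u)) (nextF→↝ f'))
    role-proper {u} (fromF refl f') (toF _ f) _ = ff (Fin.toℕ≤pred[n] (proj₁ u)) (nextF→↝ f')
    role-proper {u} (toF _ _) (toB _) _ = fb (Fin.toℕ≤pred[n] (proj₁ u)) (ι-valid (proj₂ u))
    role-proper {u} (toB _) (toF _ _) _ = ≢-sym (fb (Fin.toℕ≤pred[n] (proj₁ u)) (ι-valid (proj₂ u)))
    role-proper {u} (fromF refl f) (toB _) _ = fb′ (Fin.toℕ≤pred[n] (proj₁ u)) (nextF→↝ f)
    role-proper {u} (toB _) (fromF refl f) _ = ≢-sym (fb′ (Fin.toℕ≤pred[n] (proj₁ u)) (nextF→↝ f))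
    role-proper (toF _ _) (fromB b) _ = ≢-sym (bf (nextB→link b))
    role-proper (fromB b) (toF _ _) _ = bf (nextB→link b)
    role-proper (fromF refl f) (fromB b) _ = ≢-sym (bf′ (nextB→link b) (nextF→↝ f))
    role-proper (fromB b) (fromF refl f) _ = bf′ (nextB→link b) (nextF→↝ f)
    role-proper (toB _) (fromB b) _ = ≢-sym (bb (nextB→link b))
    role-proper (fromB b) (toB _) _ = bb (nextB→link b)

    data Oriented (u v : V) : Fin m → Set where
      forth : (e : Arc (toℕ (proj₁ u)) (ι (proj₂ u)) (toℕ (proj₁ v)) (ι (proj₂ v))) → Oriented u v (colour colF colB e)
      back  : (e : Arc (toℕ (proj₁ v)) (ι (proj₂ v)) (toℕ (proj₁ u)) (ι (proj₂ u))) → Oriented u v (colour colF colB e)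

    orient : ∀ {u v x} → Role u v x → Oriented u v x
    orient {u} (toF refl f)   = forth (fibre (Fin.toℕ≤pred[n] (proj₁ u)) (nextF→↝ f))
    orient {u} (fromF refl f) = back (fibre (Fin.toℕ≤pred[n] (proj₁ u)) (nextF→↝ f))
    orient (toB b)   = forth (base (nextB→link b))
    orient (fromB b) = back (base (nextB→link b))

    oriented-nc : ∀ {a b c d x y} → Oriented a b x → Oriented c d y → x ≡ y →
                  NonCrossing (place a) (place b) (place c) (place d)
    oriented-nc (forth e) (forth f) q = nc e f q
    oriented-nc (forth e) (back f)  q = nc-flipʳ (nc e f q)
    oriented-nc (back e)  (forth f) q = nc-flipˡ (nc e f q)
    oriented-nc (back e)  (back f)  q = nc-flipˡ (nc-flipʳ (nc e f q))

    embedding : MatchingBookEmbedding V Adj m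
    embedding = record
      { pos     = place
      ; pos-inj = λ {u} {v} e →
          let i≡ , j≡ = pos-injective (Fin.toℕ≤pred[n] (proj₁ u)) (Fin.toℕ≤pred[n] (proj₁ v))
                          (ι-valid (proj₂ u)) (ι-valid (proj₂ v)) e
          in ×-≡,≡→≡ (Fin.toℕ-injective i≡ , ι-injective j≡)
      ; col     = edgeCol
      ; col-sym = edgeCol-sym
      ; proper  = λ u v w a b → role-proper (role a) (role b)
      ; noCross = λ a b c d e f a<c c<b b<d q →
          oriented-nc (orient (role e)) (orient (role f)) q
            (inj₁ (inj₁ (a<c , c<b))) (inj₂ (inj₁ (c<b , b<d)))
      }

-- Normalising the reflection

module _ {T : ℕ} where

  residue-cases : ∀ {x r} → x ≤ T + T → x % suc T ≡ r → x ≡ r ⊎ x ≡ suc (T + r)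
  residue-cases {x} x≤ e with x ≤? T
  ... | yes x≤T = inj₁ (trans (sym (m≤n⇒m%n≡m x≤T)) e)
  ... | no x≰T  = inj₂ (trans (sym y+) (cong suc (cong (T +_) (trans (sym rem) e))))
    where
    y = x ∸ suc T
    y+ : suc T + y ≡ x
    y+ = m+[n∸m]≡n (≰⇒> x≰T)
    y≤T : y ≤ T
    y≤T = +-cancelˡ-≤ (suc T) y T (subst (_≤ suc T + T) (sym y+) (≤-trans x≤ (n≤1+n _)))
    rem : x % suc T ≡ y
    rem = begin
      x % suc T           ≡⟨ cong (_% suc T) y+ ⟨
      (suc T + y) % suc T ≡⟨ cong (_% suc T) (+-comm (suc T) y) ⟩
      (y + suc T) % suc T ≡⟨ [m+n]%n≡m%n y (suc T) ⟩
      y % suc T           ≡⟨ m≤n⇒m%n≡m y≤T ⟩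
      y                   ∎
      where open ≡-Reasoning

  twist-0 : ∀ {j j'} → j ≤ T → j' ≤ T → (j + j') % suc T ≡ 0 → (j ≡ 0 × j' ≡ 0) ⊎ j + j' ≡ suc T
  twist-0 {j} j≤ j'≤ e with residue-cases (+-mono-≤ j≤ j'≤) e
  ... | inj₁ z = inj₁ (m+n≡0⇒m≡0 j z , m+n≡0⇒n≡0 j z)
  ... | inj₂ z = inj₂ (trans z (cong suc (+-identityʳ T)))

  -- The other candidate with this residue is `2T + 1`, which exceeds every sum of two coordinates.
  -- So this normal form reverses all of `0, …, T`, whereas residue 0 singles out the point 0.
  twist-T : ∀ {j j'} → j ≤ T → j' ≤ T → (j + j') % suc T ≡ T → j + j' ≡ T
  twist-T {j} {j'} j≤ j'≤ e with residue-cases (+-mono-≤ j≤ j'≤) e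
  ... | inj₁ z = z
  ... | inj₂ z = contradiction (subst (_≤ T + T) z (+-mono-≤ j≤ j'≤)) (<⇒≱ ≤-refl)

  %-+ˡ : ∀ m n → (m % suc T + n) % suc T ≡ (m + n) % suc T
  %-+ˡ m n = begin
    (m % suc T + n) % suc T                       ≡⟨ %-distribˡ-+ (m % suc T) n (suc T) ⟩
    (m % suc T % suc T + n % suc T) % suc T       ≡⟨ cong (λ a → (a + n % suc T) % suc T) (m%n%n≡m%n m (suc T)) ⟩
    (m % suc T + n % suc T) % suc T               ≡⟨ %-distribˡ-+ m n (suc T) ⟨
    (m + n) % suc T                               ∎
    where open ≡-Reasoning

  rotate : ℕ → ℕ → ℕ
  rotate k j = (j + k) % suc T

  rotate-≤ : ∀ k j → rotate k j ≤ T
  rotate-≤ k j = s≤s⁻¹ (m%n<n (j + k) (suc T))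

  -- A further rotation by `k * T` undoes the one by `k`, since `k + k * T` is a multiple of
  -- `suc T`.
  rotate-injective : ∀ k {j j'} → j ≤ T → j' ≤ T → rotate k j ≡ rotate k j' → j ≡ j'
  rotate-injective k {j} {j'} j≤ j'≤ e = trans (sym (unrotate j≤)) (trans (cong (λ x → (x + k * T) % suc T) e) (unrotate j'≤))
    where
    open ≡-Reasoning
    full : ∀ j k T → j + k + k * T ≡ j + k * suc T
    full = solve-∀
    unrotate : ∀ {j} → j ≤ T → (rotate k j + k * T) % suc T ≡ j
    unrotate {j} j≤ = begin
      (rotate k j + k * T) % suc T  ≡⟨ %-+ˡ (j + k) (k * T) ⟩
      (j + k + k * T) % suc T       ≡⟨ cong (_% suc T) (full j k T) ⟩
      (j + k * suc T) % suc T       ≡⟨ [m+kn]%n≡m%n j k (suc T) ⟩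
      j % suc T                     ≡⟨ m≤n⇒m%n≡m j≤ ⟩
      j                             ∎

  rotate-suc : ∀ k j → (suc (rotate k j) ≤ T × rotate k (suc j) ≡ suc (rotate k j))
                     ⊎ (rotate k j ≡ T × rotate k (suc j) ≡ 0)
  rotate-suc k j with rotate k j ≟ T
  ... | yes e = inj₂ (e , (begin
      suc (j + k) % suc T        ≡⟨ cong (_% suc T) (+-comm (j + k) 1) ⟨
      (j + k + 1) % suc T        ≡⟨ %-+ˡ (j + k) 1 ⟨
      (rotate k j + 1) % suc T   ≡⟨ cong (_% suc T) (+-comm (rotate k j) 1) ⟩
      suc (rotate k j) % suc T   ≡⟨ cong (λ x → suc x % suc T) e ⟩
      suc T % suc T              ≡⟨ n%n≡0 (suc T) ⟩
      0                          ∎))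
    where open ≡-Reasoning
  ... | no ne = inj₁ (lt , (begin
      suc (j + k) % suc T        ≡⟨ cong (_% suc T) (+-comm (j + k) 1) ⟨
      (j + k + 1) % suc T        ≡⟨ %-+ˡ (j + k) 1 ⟨
      (rotate k j + 1) % suc T   ≡⟨ cong (_% suc T) (+-comm (rotate k j) 1) ⟩
      suc (rotate k j) % suc T   ≡⟨ m≤n⇒m%n≡m lt ⟩
      suc (rotate k j)           ∎))
    where
    open ≡-Reasoning
    lt : rotate k j < T
    lt = ≤∧≢⇒< (rotate-≤ k j) ne

  rotate-wrap : ∀ k → rotate k (suc T) ≡ rotate k 0
  rotate-wrap k = trans (cong (_% suc T) (+-comm (suc T) k)) ([m+n]%n≡m%n k (suc T))

  rotate-+ : ∀ k j j' → (rotate k j + rotate k j') % suc T ≡ (j + j' + (k + k)) % suc T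
  rotate-+ k j j' = trans (sym (%-distribˡ-+ (j + k) (j' + k) (suc T))) (cong (_% suc T) (regroup j j' k))
    where
    regroup : ∀ j j' k → (j + k) + (j' + k) ≡ j + j' + (k + k)
    regroup = solve-∀

-- Integer coordinates 0, …, T on the fibre in which the reflection is j ↦ c₀ - j.
record Unrolling (T c₀ : ℕ) (G : Fibre) : Set where
  open Fibre G
  field
    view           : ℕ → Point
    view-injective : ∀ {j j'} → j ≤ T → j' ≤ T → view j ≡ view j' → j ≡ j'
    view-valid     : ∀ {j} → j ≤ T → Valid (view j)
    view-step      : ∀ {j} → suc j ≤ T → view j ↝ view (suc j)
    view-wrap      : view T ↝ view 0
    view-twist     : ∀ {j j'} → j ≤ T → j' ≤ T → (j + j') % suc T ≡ c₀ → view j ⋈ view j'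

module _ {T : ℕ} {φ : Fin (suc T) → Fin (suc T)} (ρ : IsReflection (suc T) φ) where

  private
    c = proj₁ ρ
    refl-φ = proj₂ ρ

  reflection-residue : ∀ j → (toℕ j + toℕ (φ j)) % suc T ≡ toℕ c
  reflection-residue j = begin
    (toℕ j + toℕ (φ j)) % suc T  ≡⟨ cong (_% suc T) (+-comm (toℕ j) _) ⟩
    (toℕ (φ j) + toℕ j) % suc T  ≡⟨ lemma (refl-φ j) ⟩
    toℕ c % suc T                ≡⟨ m≤n⇒m%n≡m (Fin.toℕ≤pred[n] c) ⟩
    toℕ c                        ∎
    where
    open ≡-Reasoning
    lemma : ∀ {x} → x ≡ toℕ c ⊎ x ≡ toℕ c + suc T → x % suc T ≡ toℕ c % suc T
    lemma (inj₁ refl) = refl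
    lemma (inj₂ refl) = [m+n]%n≡m%n (toℕ c) (suc T)

  -- If `φ j ≡ φ j'`, rotation by this common value takes both `j` and `j'` to `c`.
  reflection-injective : Injective _≡_ _≡_ φ
  reflection-injective {j} {j'} e = Fin.toℕ-injective
    (rotate-injective (toℕ (φ j)) (Fin.toℕ≤pred[n] j) (Fin.toℕ≤pred[n] j')
      (trans (reflection-residue j)
        (sym (trans (cong (λ x → (toℕ j' + toℕ x) % suc T) e) (reflection-residue j')))))

  -- Rotation by `k` shifts both `j` and `φ j`, so the constant of the reflection changes from `c`
  -- to `c + 2k`.
  coordinates : ∀ {c₀ G} k → (toℕ c + (k + k)) % suc T ≡ c₀ → Unrolling T c₀ G → Coordinates T φ G
  coordinates {c₀} {G} k ck U = record
    { ι           = ι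
    ; ι-injective = λ {j} {j'} e → Fin.toℕ-injective
                      (rotate-injective k (Fin.toℕ≤pred[n] j) (Fin.toℕ≤pred[n] j')
                        (view-injective (rotate-≤ k (toℕ j)) (rotate-≤ k (toℕ j')) e))
    ; ι-valid     = λ j → view-valid (rotate-≤ k (toℕ j))
    ; ι-step      = λ {j} {j'} e → subst (λ x → ι j ↝ view (rot x)) (sym e) (step (toℕ j))
    ; ι-wrap      = λ {j} {j'} e f → subst₂ (λ x y → view (rot x) ↝ view y) (sym e)
                      (trans (rotate-wrap k) (cong rot (sym f))) (step T)
    ; ι-twist     = λ j → view-twist (rotate-≤ k (toℕ j)) (rotate-≤ k (toℕ (φ j))) (begin
        (rot (toℕ j) + rot (toℕ (φ j))) % suc T  ≡⟨ rotate-+ k (toℕ j) (toℕ (φ j)) ⟩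
        (toℕ j + toℕ (φ j) + (k + k)) % suc T              ≡⟨ %-+ˡ (toℕ j + toℕ (φ j)) (k + k) ⟨
        ((toℕ j + toℕ (φ j)) % suc T + (k + k)) % suc T    ≡⟨ cong (λ x → (x + (k + k)) % suc T) (reflection-residue j) ⟩
        (toℕ c + (k + k)) % suc T                          ≡⟨ ck ⟩
        c₀                                                 ∎)
    }
    where
    open Fibre G
    open Unrolling U
    open ≡-Reasoning
    rot : ℕ → ℕ
    rot = rotate {T} k
    ι : Fin (suc T) → Point
    ι j = view (rot (toℕ j))
    step : ∀ x → view (rot x) ↝ view (rot (suc x))
    step x with rotate-suc {T} k x
    ... | inj₁ (lt , e) = subst (λ y → view (rot x) ↝ view y) (sym e) (view-step lt)
    ... | inj₂ (e , f)  = subst₂ (λ x y → view x ↝ view y) (sym e) (sym f) view-wrap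

private
  -- Modulo `suc T` one has `T ≡ -1`, so an even `n = 2h` is cancelled by `k = h * T`. If `T = 2r`,
  -- then `r` is minus one half modulo `suc T`, and `k = n * r` works for every `n`.
  halves : ∀ {n} T → odd n ≡ false ⊎ odd T ≡ false → ∃ λ k → ∃ λ l → n + (k + k) ≡ l * suc T
  halves {n} T (inj₁ e) with odd-halve n e
  ... | h , refl = h * T , h + h , eq h T
    where
    eq : ∀ h T → h + h + (h * T + h * T) ≡ (h + h) * suc T
    eq = solve-∀
  halves {n} T (inj₂ e) with odd-halve T e
  ... | r , refl = n * r , n , eq n r
    where
    eq : ∀ n r → n + (n * r + n * r) ≡ n * suc (r + r)
    eq = solve-∀

normalise-0 : ∀ c T → odd c ≡ false ⊎ odd T ≡ false → ∃ λ k → (c + (k + k)) % suc T ≡ 0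
normalise-0 c T p with halves {c} T p
... | k , l , e = k , trans (cong (_% suc T) e) (m*n%n≡0 l (suc T))

normalise-T : ∀ c T → odd c ≡ true ⊎ odd T ≡ false → ∃ λ k → (c + (k + k)) % suc T ≡ T
-- The residue `T` is `-1`, so `c + 2k ≡ T` amounts to `suc c + 2k ≡ 0`; an odd `c` makes `suc c`
-- even.
normalise-T c T p with halves {suc c} T ([ inj₁ ∘ cong not , inj₂ ]′ p)
... | k , suc l , e = k , (begin
    (c + (k + k)) % suc T   ≡⟨ cong (_% suc T) (suc-injective e) ⟩
    (T + l * suc T) % suc T ≡⟨ [m+kn]%n≡m%n T l (suc T) ⟩
    T % suc T               ≡⟨ m≤n⇒m%n≡m ≤-refl ⟩
    T                       ∎)
  where open ≡-Reasoning

-- Layouts by fibres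

data Cyclic (T : ℕ) : ℕ → ℕ → Set where
  step : ∀ {j} → suc j ≤ T → Cyclic T j (suc j)
  wrap : Cyclic T T 0

line : ℕ → (ℕ → ℕ → Set) → Fibre
line T R = record { Point = ℕ ; Valid = _≤ T ; _↝_ = Cyclic T ; _⋈_ = R }

beyond-block : ∀ {i b} → i ≢ b → Beyond i b b
beyond-block {i} {b} ne with <-cmp i b
... | tri< lt _ _ = inj₁ (lt , lt)
... | tri≈ _ e _  = contradiction e ne
... | tri> _ _ gt = inj₂ (gt , gt)

-- The parameters treat the pairs of arcs for which shortness, nesting and the order of the blocks
-- are not enough: an arc closing a fibre against a base arc at that fibre, base arcs over
-- consecutive base edges, a twisted arc against a base arc at the first or last fibre, and two
-- twisted arcs.
module LineNonCrossing
  (T S : ℕ) (R : ℕ → ℕ → Set) (R-≤ : ∀ {j j'} → R j j' → j ≤ T × j' ≤ T)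
  {m : ℕ} (colF colB : ℕ → ℕ → Fin m)
  (wrap-level  : ∀ i i' j → colF i T ≡ colB i' j → suc i' ≤ S → i ≢ i' × i ≢ suc i')
  (wrap-twist  : ∀ i {j j'} → R j j' → colF i T ≡ colB S j → i ≢ 0 × i ≢ S)
  (level-level : ∀ i j j' → j ≤ T → j' ≤ T → colB i j ≡ colB (suc i) j' →
                 NonCrossing (snake T i j) (snake T (suc i) j) (snake T (suc i) j') (snake T (suc (suc i)) j'))
  (level-twist : ∀ i k {j j'} → R j j' → colB i k ≡ colB S j → suc i ≤ S → 0 < i × suc i < S)
  (twist-twist : ∀ {j j' k k'} → R j j' → R k k' → colB S j ≡ colB S k →
                 NonCrossing (snake T S j) (snake T 0 j') (snake T S k) (snake T 0 k'))
  where
  open Bundle (line T R) S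

  line-nc : ∀ {i p i' q k r k' z} (e : Arc i p i' q) (f : Arc k r k' z) → colour colF colB e ≡ colour colF colB f →
            NonCrossing (snake T i p) (snake T i' q) (snake T k r) (snake T k' z)
  line-nc {i} (fibre _ (step lt)) _ _ = nc-step i lt
  line-nc {k = k} (fibre _ wrap) (fibre _ (step lt)) _ = nc-swap (nc-step k lt)
  line-nc {i} {k = k} (fibre _ wrap) (fibre _ wrap) _ with i ≟ k
  ... | yes refl = nc-sum refl
  ... | no ne = nc-blocks ≤-refl z≤n ≤-refl z≤n (beyond-block ne) (beyond-block ne)
  line-nc {i} {k = k} {r} (fibre _ wrap) (base (level lt v)) e with wrap-level i k r e lt
  ... | n , n' = nc-swap (nc-blocks v v ≤-refl z≤n (beyond-block (n ∘ sym)) (beyond-block (n' ∘ sym)))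
  line-nc {i} (fibre _ wrap) (base (twist x)) e with wrap-twist i x e | R-≤ x
  ... | n , n' | u , v = nc-swap (nc-blocks u v ≤-refl z≤n (beyond-block (n' ∘ sym)) (beyond-block (n ∘ sym)))
  line-nc {k = k} (base _) (fibre _ (step lt)) _ = nc-swap (nc-step k lt)
  line-nc (base l@(level _ _)) f@(fibre _ wrap) e = nc-swap (line-nc f (base l) (sym e))
  line-nc (base l@(twist _))   f@(fibre _ wrap) e = nc-swap (line-nc f (base l) (sym e))
  line-nc {i} {p} {k = k} {r} (base (level _ v)) (base (level _ v')) e with <-cmp i k
  ... | tri≈ _ refl _ = nc-adjacent i v v v' v' (+-comm p r)
  ... | tri< lt _ _ with suc i ≟ k
  ...   | yes refl = level-level i p r v v' e
  ...   | no ne = nc-far i k v v v' v' (≤∧≢⇒< lt ne)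
  line-nc {i} {p} {k = k} {r} (base (level _ v)) (base (level _ v')) e | tri> _ _ gt with suc k ≟ i
  ...   | yes refl = nc-swap (level-level k r p v' v (sym e))
  ...   | no ne = nc-swap (nc-far k i v' v' v v (≤∧≢⇒< gt ne))
  line-nc {i} {p} (base (level lt v)) (base (twist x)) e with level-twist i p x e lt | R-≤ x
  ... | pos , top | y , z = nc-swap (nc-blocks y z v v (inj₂ (lt , top)) (inj₁ (pos , s≤s z≤n)))
  line-nc (base l@(twist _)) (base l'@(level _ _)) e = nc-swap (line-nc (base l') (base l) (sym e))
  line-nc (base (twist x)) (base (twist y)) e = twist-twist x y e

snake-odd-< : ∀ {w} b {o o'} → odd b ≡ true → o ≤ w → o' < o → snake w b o < snake w b o'
snake-odd-< {w} b e o≤w o'<o rewrite e = +-monoʳ-< (b * suc w) (∸-monoʳ-< o'<o o≤w)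

distinct? : ∀ {n l m} (f g : Fin n → Fin l → Fin m) → Dec (∀ x y → f x y ≢ g x y)
distinct? f g = Fin.all? λ x → Fin.all? λ y → ¬? (f x y Fin.≟ g x y)

-- For even `S` the blocks `0` and `S` both run forwards, so the sum of the positions is a constant
-- plus `j + j'`, which a reflection keeps fixed modulo `suc T`.
nc-mirror : ∀ {T S j j' k k'} → odd S ≡ false → j + j' ≡ k + k' →
            NonCrossing (snake T S j) (snake T 0 j') (snake T S k) (snake T 0 k')
nc-mirror {T} {S} {j} {j'} {k} {k'} S-even e = nc-sum (begin
  snake T S j + j'          ≡⟨ cong (_+ j') (snake-even {b = S} S-even) ⟩
  S * suc T + j + j'        ≡⟨ +-assoc (S * suc T) j j' ⟩
  S * suc T + (j + j')      ≡⟨ cong (S * suc T +_) e ⟩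
  S * suc T + (k + k')      ≡⟨ +-assoc (S * suc T) k k' ⟨
  S * suc T + k + k'        ≡⟨ cong (_+ k') (snake-even {b = S} S-even) ⟨
  snake T S k + k'          ∎)
  where open ≡-Reasoning

Realised : ∀ {k} {A : Set} → (Fin k → A × A) → A → A → Set
Realised arc x y = ∃ λ e → arc e ≡ (x , y)

-- Colourings read off finite tables indexed by a row class and a column class; the
-- local conditions are then decided by evaluation.
module Tables {n k a b m : ℕ} (T : ℕ) (row : ℕ → Fin n) (column : ℕ → Fin k)
  (rowArc : Fin a → Fin n × Fin n) (colArc : Fin b → Fin k × Fin k)
  (row-suc : ∀ i → Realised rowArc (row i) (row (suc i)))
  (column-next : ∀ {j j'} → Cyclic T j j' → Realised colArc (column j) (column j'))
  (tableF tableB : Fin n → Fin k → Fin m) where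

  colF colB : ℕ → ℕ → Fin m
  colF i j = tableF (row i) (column j)
  colB i j = tableB (row i) (column j)

  private
    rowSrc rowTgt : Fin a → Fin n
    rowSrc = proj₁ ∘ rowArc
    rowTgt = proj₂ ∘ rowArc
    colSrc colTgt : Fin b → Fin k
    colSrc = proj₁ ∘ colArc
    colTgt = proj₂ ∘ colArc

  ff : {True (distinct? (λ r e → tableF r (colSrc e)) (λ r e → tableF r (colTgt e)))} →
       ∀ i {j j'} → Cyclic T j j' → colF i j ≢ colF i j'
  ff {t} i x with column-next x
  ... | e , p = subst (λ (x , y) → tableF (row i) x ≢ tableF (row i) y) p (toWitness t (row i) e)

  fb : {True (distinct? tableF tableB)} → ∀ i j → colF i j ≢ colB i j
  fb {t} i j = toWitness t (row i) (column j)

  fb′ : {True (distinct? (λ r e → tableF r (colSrc e)) (λ r e → tableB r (colTgt e)))} →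
        ∀ i {j j'} → Cyclic T j j' → colF i j ≢ colB i j'
  fb′ {t} i x with column-next x
  ... | e , p = subst (λ (x , y) → tableF (row i) x ≢ tableB (row i) y) p (toWitness t (row i) e)

  bb : {True (distinct? (λ e q → tableB (rowSrc e) q) (λ e q → tableB (rowTgt e) q))} →
       ∀ i j → colB i j ≢ colB (suc i) j
  bb {t} i j with row-suc i
  ... | e , p = subst (λ (x , y) → tableB x (column j) ≢ tableB y (column j)) p (toWitness t e (column j))

  bf : {True (distinct? (λ e q → tableB (rowSrc e) q) (λ e q → tableF (rowTgt e) q))} →
       ∀ i j → colB i j ≢ colF (suc i) j
  bf {t} i j with row-suc i
  ... | e , p = subst (λ (x , y) → tableB x (column j) ≢ tableF y (column j)) p (toWitness t e (column j))

  bf′ : {True (distinct? (λ e e' → tableB (rowSrc e) (colTgt e')) (λ e e' → tableF (rowTgt e) (colSrc e')))} →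
        ∀ i {j j'} → Cyclic T j j' → colB i j' ≢ colF (suc i) j
  bf′ {t} i x with row-suc i | column-next x
  ... | e , p | e' , q = subst₂ (λ (x , y) (v , w) → tableB x w ≢ tableF y v) p q (toWitness t e e')

  -- The arc from `T` to `0` spans its whole fibre, so its colour has to differ from that of every
  -- base arc leaving the fibre, in any column; `wrap≢level′` is the same for base arcs entering it.
  wrap≢level : ∀ last → {True (distinct? (λ r q → tableF r last) tableB)} → column T ≡ last →
               ∀ i j → colF i T ≢ colB i j
  wrap≢level last {t} refl i j = toWitness t (row i) (column j)

  wrap≢level′ : ∀ last → {True (distinct? (λ e q → tableF (rowTgt e) last) (λ e q → tableB (rowSrc e) q))} → column T ≡ last →
                ∀ i j → colF (suc i) T ≢ colB i j
  wrap≢level′ last {t} refl i j with row-suc i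
  ... | e , p = subst (λ (x , y) → tableF y last ≢ tableB x (column j)) p (toWitness t e (column j))

line-unrolling : ∀ {T c₀ R} → (∀ {j j'} → j ≤ T → j' ≤ T → (j + j') % suc T ≡ c₀ → R j j') →
                 Unrolling T c₀ (line T R)
line-unrolling twisted = record
  { view           = λ j → j
  ; view-injective = λ _ _ e → e
  ; view-valid     = λ j≤ → j≤
  ; view-step      = step
  ; view-wrap      = wrap
  ; view-twist     = twisted
  }

-- c₀ = T, four pages, S even, T odd.  An odd cycle of base arcs cannot alternate between the colours
-- 0F and 1F; the extra step is gained over fibres 0, 1, 2, where the arcs from 0 to 1 (columns ≥ 2)
-- and from 1 to 2 (columns 0, 1) may share 2F, because on fibre 1 the former end before the latter start.
module FourPageOdd (S T : ℕ) (2≤S : 2 ≤ S) (2≤T : 2 ≤ T) (S-even : odd S ≡ false) (T-odd : odd T ≡ true) where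

  data Mirror (j j' : ℕ) : Set where
    mirror : j + j' ≡ T → Mirror j j'

  Mirror-≤ : ∀ {j j'} → Mirror j j' → j ≤ T × j' ≤ T
  Mirror-≤ {j} {j'} (mirror e) = m+n≤o⇒m≤o j (≤-reflexive e) , m+n≤o⇒n≤o j (≤-reflexive e)

  row : ℕ → Fin 5
  row 0 = 0F
  row 1 = 1F
  row 2 = 2F
  -- The fibre is `3 + i`, so `3F` stands for the odd fibres from 3 on and `4F` for the even ones.
  -- In `column` the shift is 2 and keeps the parity.
  row (suc (suc (suc i))) = if odd i then 4F else 3F

  column : ℕ → Fin 4
  column 0 = 0F
  column 1 = 1F
  column (suc (suc j)) = if odd j then 3F else 2F

  tableF tableB : Fin 5 → Fin 4 → Fin 4
  tableF 0F 0F = 2F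
  tableF 0F 2F = 1F
  tableF 0F _  = 3F
  tableF 1F 0F = 3F
  tableF 1F 2F = 1F
  tableF 1F _  = 0F
  tableF 2F 0F = 3F
  tableF 2F 2F = 2F
  tableF 2F _  = 1F
  tableF _  0F = 2F
  tableF _  2F = 2F
  tableF _  _  = 3F
  tableB 0F 0F = 1F
  tableB 0F 1F = 1F
  tableB 0F _  = 2F
  tableB 1F 0F = 2F
  tableB 1F 1F = 2F
  tableB 1F _  = 3F
  tableB 3F _  = 1F
  tableB _  _  = 0F

  rowArc : Fin 5 → Fin 5 × Fin 5
  rowArc 0F = 0F , 1F
  rowArc 1F = 1F , 2F
  rowArc 2F = 2F , 3F
  rowArc 3F = 3F , 4F
  rowArc 4F = 4F , 3F

  colArc : Fin 5 → Fin 4 × Fin 4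
  colArc 0F = 0F , 1F
  colArc 1F = 1F , 2F
  colArc 2F = 2F , 3F
  colArc 3F = 3F , 2F
  colArc 4F = 3F , 0F

  row-suc : ∀ i → Realised rowArc (row i) (row (suc i))
  row-suc 0 = 0F , refl
  row-suc 1 = 1F , refl
  row-suc 2 = 2F , refl
  row-suc (suc (suc (suc i))) with odd i
  ... | true  = 4F , refl
  ... | false = 3F , refl

  column-odd : ∀ j → 2 ≤ j → odd j ≡ true → column j ≡ 3F
  column-odd (suc (suc j)) _ e with odd j
  column-odd (suc (suc j)) _ refl | true = refl
  column-odd 1 (s≤s ()) _

  column-next : ∀ {j j'} → Cyclic T j j' → Realised colArc (column j) (column j')
  column-next (step {0} _) = 0F , refl
  column-next (step {1} _) = 1F , refl
  column-next (step {suc (suc j)} _) with odd j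
  ... | true  = 3F , refl
  ... | false = 2F , refl
  column-next wrap = 4F , cong (_, 0F) (sym (column-odd T 2≤T T-odd))

  open Tables T row column rowArc colArc row-suc column-next tableF tableB

  row-even : ∀ i → 2 ≤ i → odd i ≡ false → row i ≡ 2F ⊎ row i ≡ 4F
  row-even 1 (s≤s ()) _
  row-even 2 _ _ = inj₁ refl
  row-even (suc (suc (suc i))) _ e with odd i
  row-even (suc (suc (suc i))) _ refl | true = inj₂ refl

  top-a : ∀ j → colB S j ≡ 0F
  top-a j with row S | row-even S 2≤S S-even
  ... | _ | inj₁ refl = refl
  ... | _ | inj₂ refl = refl

  row-odd : ∀ i → odd i ≡ true → row i ≡ 1F ⊎ row i ≡ 3F
  row-odd 1 _ = inj₁ refl
  row-odd (suc (suc (suc i))) e with odd i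
  row-odd (suc (suc (suc i))) refl | false = inj₂ refl

  layout : Layout (line T Mirror) S 4
  layout = record
    { pos  = snake T
    ; colF = colF
    ; colB = colB
    ; pos-injective = λ _ _ v v' e → snake-injective v v' e
    ; ff  = λ {i} _ → ff i
    ; fb  = λ {i} {j} _ _ → fb i j
    ; fb′ = λ {i} _ → fb′ i
    ; bb  = λ { {i} {j} (level _ _) → bb i j
              ; {_} {j} {_} {k} (twist _) → top≢ (tableB 0F) {j = j} {k = k} }
    ; bf  = λ { {i} {j} (level _ _) → bf i j
              ; {_} {j} {_} {k} (twist _) → top≢ (tableF 0F) {j = j} {k = k} }
    ; bf′ = λ { {i} (level _ _) x → bf′ i x
              ; {_} {j} {_} {_} {k} (twist _) _ → top≢ (tableF 0F) {j = j} {k = k} }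
    ; nc  = LineNonCrossing.line-nc T S Mirror Mirror-≤ colF colB
              wrap-level wrap-twist level-level level-twist twist-twist
    }
    where
    open Bundle (line T Mirror) S
    top≢ : (f : Fin 4 → Fin 4) {t : True (Fin.all? λ q → ¬? (0F Fin.≟ f q))} → ∀ {j k} → colB S j ≢ f (column k)
    top≢ f {t} {j} {k} e = toWitness t (column k) (trans (sym (top-a j)) e)

    lastColumn : column T ≡ 3F
    lastColumn = column-odd T 2≤T T-odd

    wrap-level : ∀ i i' j → colF i T ≡ colB i' j → suc i' ≤ S → i ≢ i' × i ≢ suc i'
    wrap-level i i' j e _ = n , n'
      where
      n : i ≢ i'
      n refl = wrap≢level 3F lastColumn i j e
      n' : i ≢ suc i'
      n' refl = wrap≢level′ 3F lastColumn i' j e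

    wrap-twist : ∀ i {j j'} → Mirror j j' → colF i T ≡ colB S j → i ≢ 0 × i ≢ S
    wrap-twist i {j} _ e = n , n'
      where
      n : i ≢ 0
      n refl = top≢ (λ _ → 3F) {j = j} {k = 0} (trans (sym e) (cong (tableF 0F) lastColumn))
      n' : i ≢ S
      n' refl = wrap≢level 3F lastColumn i j e

    level-level : ∀ i j j' → j ≤ T → j' ≤ T → colB i j ≡ colB (suc i) j' →
                  NonCrossing (snake T i j) (snake T (suc i) j) (snake T (suc i) j') (snake T (suc (suc i)) j')
    level-level 0 j j' v v' e =
      -- Equal colours can only be `2F`, so `j` is at least 2 and `j'` at most 1. Fibre 1 runs
      -- backwards, hence the first chord has ended where the second begins.
      nc-beyond {r = snake T 1 j'} {z = snake T 2 j'} (inj₁ (snake-< {b = 0} {1} {j} {j'} ≤-refl v , snake-< {b = 0} {2} (s≤s z≤n) v))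
                (inj₁ (snake-odd-< {T} 1 {j} {j'} refl v (late j j' e) , snake-< {b = 1} {2} ≤-refl v))
      where
      late : ∀ j j' → colB 0 j ≡ colB 1 j' → j' < j
      late (suc (suc j)) 0 _ = s≤s z≤n
      late (suc (suc j)) 1 _ = s≤s (s≤s z≤n)
      late (suc (suc j)) (suc (suc j')) e with odd j | odd j'
      late (suc (suc j)) (suc (suc j')) () | true | true
      late (suc (suc j)) (suc (suc j')) () | true | false
      late (suc (suc j)) (suc (suc j')) () | false | true
      late (suc (suc j)) (suc (suc j')) () | false | false
      late 0 0 ()
      late 0 1 ()
      late 1 0 ()
      late 1 1 ()
      late 0 (suc (suc j')) e with odd j'
      late 0 (suc (suc j')) () | true
      late 0 (suc (suc j')) () | false
      late 1 (suc (suc j')) e with odd j'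
      late 1 (suc (suc j')) () | true
      late 1 (suc (suc j')) () | false
    -- From fibre 1 on, consecutive rows have disjoint sets of base colours. `row-suc⁺` discards the
    -- transition out of row 0, the only one for which this fails.
    level-level (suc i) j j' _ _ e = contradiction e (apart i)
      where
      row-suc⁺ : ∀ i → ∃ λ e → rowArc (Fin.suc e) ≡ (row (suc i) , row (suc (suc i)))
      row-suc⁺ i with row-suc (suc i)
      ... | Fin.suc x , p = x , p
      row-suc⁺ 0 | 0F , ()
      row-suc⁺ 1 | 0F , ()
      row-suc⁺ (suc (suc i)) | 0F , p with odd i
      row-suc⁺ (suc (suc i)) | 0F , () | true
      row-suc⁺ (suc (suc i)) | 0F , () | false
      bb⁺ : ∀ x q q' → tableB (proj₁ (rowArc (Fin.suc x))) q ≢ tableB (proj₂ (rowArc (Fin.suc x))) q'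
      bb⁺ = toWitness {a? = Fin.all? λ x → Fin.all? λ q → Fin.all? λ q' →
              ¬? (tableB (proj₁ (rowArc (Fin.suc x))) q Fin.≟ tableB (proj₂ (rowArc (Fin.suc x))) q')} _
      apart : ∀ i → colB (suc i) j ≢ colB (suc (suc i)) j'
      apart i with row-suc⁺ i
      ... | x , p = subst (λ (a , b) → tableB a (column j) ≢ tableB b (column j')) p (bb⁺ x (column j) (column j'))

    level-twist : ∀ i k {j j'} → Mirror j j' → colB i k ≡ colB S j → suc i ≤ S → 0 < i × suc i < S
    level-twist i k {j} _ e lt = pos i e , ≤∧≢⇒< lt top
      where
      pos : ∀ i → colB i k ≡ colB S j → 0 < i
      pos 0 e = contradiction (sym e) (top≢ (tableB 0F) {j = j} {k = k})
      pos (suc i) _ = s≤s z≤n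
      tableB-1≢a : ∀ q → tableB 1F q ≢ 0F
      tableB-1≢a = toWitness {a? = Fin.all? λ q → ¬? (tableB 1F q Fin.≟ 0F)} _
      top : suc i ≢ S
      top eq with row i | row-odd i (trans (sym (not-involutive _)) (cong not (trans (cong odd eq) S-even))) | trans e (top-a j)
      ... | _ | inj₁ refl | x = tableB-1≢a (column k) x
      ... | _ | inj₂ refl | x = contradiction x λ ()

    twist-twist : ∀ {j j' k k'} → Mirror j j' → Mirror k k' → colB S j ≡ colB S k →
                  NonCrossing (snake T S j) (snake T 0 j') (snake T S k) (snake T 0 k')
    twist-twist (mirror e) (mirror f) _ = nc-mirror {T} {S} S-even (trans e (sym f))

  unrolling : Unrolling T T (line T Mirror)
  unrolling = line-unrolling λ u v e → mirror (twist-T u v e)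

-- c₀ = 0, five pages, S even.  The twisted arcs are nested except the one joining (S , 0) to (0 , 0),
-- which crosses the others; so column 0 replaces colour 0F by 3F, which otherwise only colours arcs
-- between consecutive positions.
module FivePageOdd (S T : ℕ) (2≤S : 2 ≤ S) (2≤T : 2 ≤ T) (S-even : odd S ≡ false) where

  data Pole : ℕ → ℕ → Set where
    origin : Pole 0 0
    mirror : ∀ {j j'} → j ≤ T → j' ≤ T → j + j' ≡ suc T → Pole j j'

  Pole-≤ : ∀ {j j'} → Pole j j' → j ≤ T × j' ≤ T
  Pole-≤ origin         = z≤n , z≤n
  Pole-≤ (mirror u v _) = u , v

  row : ℕ → Fin 4
  row 0 = 0F
  row 1 = 1F
  row (suc (suc i)) = if odd i then 3F else 2F

  inner : ℕ → Fin 4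
  inner 0       = 0F
  inner (suc j) = if odd j then 2F else 1F

  -- `T` may have either parity, so the last column is a class of its own. The arc leaving it spans
  -- the fibre and takes the one of `0F`, `1F`, `2F` that no base arc at this fibre has.
  column : ℕ → Fin 4
  column j with j ≟ T
  ... | yes _ = 3F
  ... | no  _ = inner j

  tableF tableB : Fin 4 → Fin 4 → Fin 5
  tableF 0F 3F = 1F
  tableF 1F 3F = 0F
  tableF _  3F = 2F
  tableF _  1F = 3F
  tableF _  _  = 4F
  tableB 0F _  = 2F
  tableB 2F 0F = 3F
  tableB 2F _  = 0F
  tableB _  _  = 1F

  rowArc : Fin 4 → Fin 4 × Fin 4
  rowArc 0F = 0F , 1F
  rowArc 1F = 1F , 2F
  rowArc 2F = 2F , 3F
  rowArc 3F = 3F , 2F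

  colArc : Fin 6 → Fin 4 × Fin 4
  colArc 0F = 0F , 1F
  colArc 1F = 1F , 2F
  colArc 2F = 2F , 1F
  colArc 3F = 1F , 3F
  colArc 4F = 2F , 3F
  colArc 5F = 3F , 0F

  row-suc : ∀ i → Realised rowArc (row i) (row (suc i))
  row-suc 0 = 0F , refl
  row-suc 1 = 1F , refl
  row-suc (suc (suc i)) with odd i
  ... | true  = 3F , refl
  ... | false = 2F , refl

  column-last : column T ≡ 3F
  column-last with T ≟ T
  ... | yes _ = refl
  ... | no ne = contradiction refl ne

  column-inner : ∀ {j} → j ≢ T → column j ≡ inner j
  column-inner {j} ne with j ≟ T
  ... | yes e = contradiction e ne
  ... | no _  = refl

  0≢T : 0 ≢ T
  0≢T = <⇒≢ (≤-trans (s≤s z≤n) 2≤T)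

  column-next : ∀ {j j'} → Cyclic T j j' → Realised colArc (column j) (column j')
  column-next wrap = 5F , cong₂ _,_ (sym column-last) (sym (column-inner 0≢T))
  column-next (step {j} lt) with suc j ≟ T
  ... | no _ = subst (λ x → Realised colArc x (inner (suc j))) (sym (column-inner (<⇒≢ lt))) (go j)
    where
    go : ∀ j → Realised colArc (inner j) (inner (suc j))
    go 0 = 0F , refl
    go (suc j) with odd j
    ... | true  = 2F , refl
    ... | false = 1F , refl
  ... | yes e = subst (λ x → Realised colArc x 3F) (sym (column-inner (<⇒≢ lt))) (go j e)
    where
    go : ∀ j → suc j ≡ T → Realised colArc (inner j) 3F
    go 0 e = contradiction e (<⇒≢ 2≤T)
    go (suc j) _ with odd j
    ... | true  = 4F , refl
    ... | false = 3F , refl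

  open Tables T row column rowArc colArc row-suc column-next tableF tableB

  row-even : ∀ i → 2 ≤ i → odd i ≡ false → row i ≡ 2F
  row-even 1 (s≤s ()) _
  row-even (suc (suc i)) _ e with odd i
  row-even (suc (suc i)) _ refl | false = refl

  row-odd : ∀ i → odd i ≡ true → row i ≡ 1F ⊎ row i ≡ 3F
  row-odd 1 _ = inj₁ refl
  row-odd (suc (suc i)) e with odd i
  row-odd (suc (suc i)) refl | true = inj₂ refl

  row-top : row S ≡ 2F
  row-top = row-even S 2≤S S-even

  top-origin : colB S 0 ≡ 3F
  top-origin = cong₂ tableB row-top (column-inner 0≢T)

  top-mirror : ∀ {j j'} → j' ≤ T → j + j' ≡ suc T → colB S j ≡ 0F
  top-mirror {zero}  le e = contradiction (≤-reflexive (sym e)) (<⇒≱ (s≤s le))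
  top-mirror {suc j} _ _ = trans (cong (λ r → tableB r (column (suc j))) row-top) (go (suc j ≟ T))
    where
    go : Dec (suc j ≡ T) → tableB 2F (column (suc j)) ≡ 0F
    go (yes e) = cong (tableB 2F) (trans (cong column e) column-last)
    go (no ne) = trans (cong (tableB 2F) (column-inner ne)) (pos j)
      where
      pos : ∀ j → tableB 2F (inner (suc j)) ≡ 0F
      pos j with odd j
      ... | true  = refl
      ... | false = refl

  layout : Layout (line T Pole) S 5
  layout = record
    { pos  = snake T
    ; colF = colF
    ; colB = colB
    ; pos-injective = λ _ _ v v' e → snake-injective v v' e
    ; ff  = λ {i} _ → ff i
    ; fb  = λ {i} {j} _ _ → fb i j
    ; fb′ = λ {i} _ → fb′ i
    ; bb  = λ { {i} {j} (level _ _) → bb i j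
              ; {_} {j} {_} {k} (twist _) → top≢ (λ _ → tableB 0F) {j = j} {k = k} }
    ; bf  = λ { {i} {j} (level _ _) → bf i j ; (twist x) → bf-top x }
    ; bf′ = λ { {i} (level _ _) x → bf′ i x ; (twist x) y → bf′-top x y }
    ; nc  = LineNonCrossing.line-nc T S Pole Pole-≤ colF colB
              wrap-level wrap-twist level-level level-twist twist-twist
    }
    where
    open Bundle (line T Pole) S

    top≢ : (f : Fin 4 → Fin 4 → Fin 5) {t : True (distinct? (λ q q' → tableB 2F q) f)} → ∀ {j k} → colB S j ≢ f (column j) (column k)
    top≢ f {t} {j} {k} e = toWitness t (column j) (column k) (trans (cong (λ r → tableB r (column j)) (sym row-top)) e)

    -- A check over all pairs of column classes would fail: `3F`, the colour of the twisted arc at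
    -- the origin, also occurs on fibre 0. But the two fibre arcs that this twisted arc meets at
    -- `(0 , 0)` have colours `4F` and `1F`.
    bf-top : ∀ {j j'} → Pole j j' → colB S j ≢ colF 0 j'
    bf-top origin e = contradiction (trans (sym top-origin) (trans e (cong (tableF 0F) (column-inner 0≢T)))) λ ()
    bf-top {j} {j'} (mirror _ v eq) e = a≢ (column j') (trans (sym (top-mirror v eq)) e)
      where
      a≢ : ∀ q → 0F ≢ tableF 0F q
      a≢ = toWitness {a? = Fin.all? λ q → ¬? (0F Fin.≟ tableF 0F q)} _

    bf′-top : ∀ {j j' k} → Pole j j' → Cyclic T k j' → colB S j ≢ colF 0 k
    bf′-top origin wrap e = contradiction (trans (sym top-origin) (trans e (cong (tableF 0F) column-last))) λ ()
    bf′-top {k = k} (mirror _ v eq) _ e = a≢ (column k) (trans (sym (top-mirror v eq)) e)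
      where
      a≢ : ∀ q → 0F ≢ tableF 0F q
      a≢ = toWitness {a? = Fin.all? λ q → ¬? (0F Fin.≟ tableF 0F q)} _

    wrap-level : ∀ i i' j → colF i T ≡ colB i' j → suc i' ≤ S → i ≢ i' × i ≢ suc i'
    wrap-level i i' j e _ = (λ { refl → wrap≢level 3F column-last i j e })
                          , (λ { refl → wrap≢level′ 3F column-last i' j e })

    wrap-twist : ∀ i {j j'} → Pole j j' → colF i T ≡ colB S j → i ≢ 0 × i ≢ S
    wrap-twist i {j} _ e = n , λ { refl → wrap≢level 3F column-last i j e }
      where
      n : i ≢ 0
      n refl = top≢ (λ _ _ → 1F) {j = j} {k = 0} (trans (sym e) (cong (tableF 0F) column-last))

    level-level : ∀ i j j' → j ≤ T → j' ≤ T → colB i j ≡ colB (suc i) j' →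
                  NonCrossing (snake T i j) (snake T (suc i) j) (snake T (suc i) j') (snake T (suc (suc i)) j')
    level-level i j j' _ _ e with row-suc i
    ... | x , p = contradiction e (subst (λ (r , r') → tableB r (column j) ≢ tableB r' (column j')) p (apart x (column j) (column j')))
      where
      apart : ∀ x q q' → tableB (proj₁ (rowArc x)) q ≢ tableB (proj₂ (rowArc x)) q'
      apart = toWitness {a? = Fin.all? λ x → Fin.all? λ q → Fin.all? λ q' →
                ¬? (tableB (proj₁ (rowArc x)) q Fin.≟ tableB (proj₂ (rowArc x)) q')} _

    level-twist : ∀ i k {j j'} → Pole j j' → colB i k ≡ colB S j → suc i ≤ S → 0 < i × suc i < S
    level-twist i k {j} _ e lt = pos i e , ≤∧≢⇒< lt top
      where
      pos : ∀ i → colB i k ≡ colB S j → 0 < i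
      pos 0 e = contradiction (sym e) (top≢ (λ _ → tableB 0F) {j = j} {k = k})
      pos (suc i) _ = s≤s z≤n
      top : suc i ≢ S
      at : ∀ {r} → row i ≡ r → tableB r (column k) ≡ colB S j
      at p = trans (cong (λ r → tableB r (column k)) (sym p)) e
      top eq with row-odd i (trans (sym (not-involutive _)) (cong not (trans (cong odd eq) S-even)))
      ... | inj₁ p = top≢ (λ _ → tableB 1F) {j = j} {k = k} (sym (at p))
      ... | inj₂ p = top≢ (λ _ → tableB 3F) {j = j} {k = k} (sym (at p))

    twist-twist : ∀ {j j' k k'} → Pole j j' → Pole k k' → colB S j ≡ colB S k →
                  NonCrossing (snake T S j) (snake T 0 j') (snake T S k) (snake T 0 k')
    twist-twist origin origin _ = nc-sum {p = snake T S 0} refl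
    twist-twist origin (mirror _ v eq) e = contradiction (trans (sym top-origin) (trans e (top-mirror v eq))) λ ()
    twist-twist (mirror _ v eq) origin e = contradiction (trans (sym top-origin) (trans (sym e) (top-mirror v eq))) λ ()
    twist-twist (mirror _ _ e) (mirror _ _ f) _ = nc-mirror {T} {S} S-even (trans e (sym f))

  unrolling : Unrolling T 0 (line T Pole)
  unrolling = line-unrolling twisted
    where
    twisted : ∀ {j j'} → j ≤ T → j' ≤ T → (j + j') % suc T ≡ 0 → Pole j j'
    twisted u v e with twist-0 u v e
    ... | inj₁ (refl , refl) = origin
    ... | inj₂ x = mirror u v x

-- Layouts by orbits

nc-share : ∀ {p q r} → NonCrossing p q r q
nc-share (inj₁ x) (inj₁ y) = nope x y
  where
  nope : ∀ {p q r} → Within p q r → ¬ Within r q p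
  nope (inj₁ (a , b)) (inj₁ (c , d)) = <-asym a c
  nope (inj₁ (a , b)) (inj₂ (c , d)) = <-asym (<-trans a b) c
  nope (inj₂ (a , b)) (inj₁ (c , d)) = <-asym (<-trans a b) d
  nope (inj₂ (a , b)) (inj₂ (c , d)) = <-asym b d
nc-share (inj₁ x) (inj₂ (inj₁ (_ , y))) = <-irrefl refl y
nc-share (inj₁ x) (inj₂ (inj₂ (y , _))) = <-irrefl refl y
nc-share (inj₂ (inj₁ (_ , y))) _ = <-irrefl refl y
nc-share (inj₂ (inj₂ (y , _))) _ = <-irrefl refl y

alternate : ∀ {A : Set} → A → A → ℕ → A
alternate x y k = if odd k then y else x

alternate-odd : ∀ {A : Set} {x y : A} k → odd k ≡ true → alternate x y k ≡ y
alternate-odd k e rewrite e = refl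

alternate-parity : ∀ {A : Set} {x y : A} → x ≢ y → ∀ {k l} → alternate x y k ≡ alternate x y l → odd k ≡ odd l
alternate-parity ne {k} {l} e with odd k | odd l
... | true  | true  = refl
... | false | false = refl
... | true  | false = contradiction (sym e) ne
... | false | true  = contradiction e ne

alternate-suc : ∀ {A : Set} {x y : A} → x ≢ y → ∀ k → alternate x y k ≢ alternate x y (suc k)
alternate-suc ne k e = same-parity-suc k (alternate-parity ne {k} {suc k} e)

alternate-≢ : ∀ {A : Set} {x y z : A} → x ≢ z → y ≢ z → ∀ k → alternate x y k ≢ z
alternate-≢ p q k with odd k
... | true  = q
... | false = p

-- c₀ = 0, four pages, S odd, 2n + 4 points on the fibre.  The reflection fixes bot and top
-- and exchanges f k with g k; the vertices over an orbit form a block of the layout.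
module FourPageEven (S n : ℕ) (S-odd : odd S ≡ true) where

  T : ℕ
  T = suc n + suc (suc n)

  data Point : Set where
    bot top : Point
    f g     : ℕ → Point

  Valid : Point → Set
  Valid bot   = ⊤
  Valid top   = ⊤
  Valid (f k) = k ≤ n
  Valid (g k) = k ≤ n

  data _↝_ : Point → Point → Set where
    bf : bot ↝ f 0
    ff : ∀ {k} → suc k ≤ n → f k ↝ f (suc k)
    ft : f n ↝ top
    tg : top ↝ g n
    gg : ∀ {k} → suc k ≤ n → g (suc k) ↝ g k
    gb : g 0 ↝ bot

  data _⋈_ : Point → Point → Set where
    bb : bot ⋈ bot
    tt : top ⋈ top
    fg : ∀ {k} → k ≤ n → f k ⋈ g k
    gf : ∀ {k} → k ≤ n → g k ⋈ f k

  G : Fibre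
  G = record { Point = Point ; Valid = Valid ; _↝_ = _↝_ ; _⋈_ = _⋈_ }

  w : ℕ
  w = S + suc S

  -- Counting starts at 1 so that block 2 runs forwards. For `n = 0` the chords `inF` and `out`,
  -- both of colour `1F`, end in that block, and this direction puts the ends of `inF` before those
  -- of `out`.
  block : Point → ℕ
  block bot   = 1
  block top   = 3 + n
  block (f k) = 2 + k
  block (g k) = 2 + k

  -- The base arcs over an orbit of two points form a single cycle: along `f k`, across the twist,
  -- along `g k`, and across the twist again. The offsets follow it, so all its arcs but the closing
  -- one join consecutive positions.
  offset : ℕ → Point → ℕ
  offset i (g _) = suc S + i
  offset i _     = i

  pos : ℕ → Point → ℕ
  pos i p = snake w (block p) (offset i p)

  alt : ℕ → Fin 4
  alt = alternate 2F 0F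

  colF : Point → Fin 4
  colF bot   = 1F
  colF top   = 1F
  colF (f k) = alt k
  colF (g k) = alt (suc k)

  -- The base arcs leaving even fibres join consecutive positions, so only properness matters: this
  -- is the one of `0F`, `1F`, `2F` that neither fibre arc at the point has.
  colE : Point → Fin 4
  colE bot         = 2F
  colE top         = alt (suc n)
  colE (f zero)    = 0F
  colE (f (suc k)) = 1F
  colE (g k) with k ≟ n
  ... | yes _ = alt k
  ... | no _  = 1F

  colB : ℕ → Point → Fin 4
  colB i p = alternate (colE p) 3F i

  i≤w : ∀ {i} → i ≤ S → i ≤ w
  i≤w le = ≤-trans le (m≤m+n S (suc S))

  s+i≤w : ∀ {i} → i ≤ S → suc S + i ≤ w
  s+i≤w {i} le = ≤-trans (≤-reflexive (sym (+-suc S i))) (+-monoʳ-≤ S (s≤s le))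

  offset-≤ : ∀ {i} p → i ≤ S → offset i p ≤ w
  offset-≤ bot   = i≤w
  offset-≤ top   = i≤w
  offset-≤ (f k) = i≤w
  offset-≤ (g k) = s+i≤w

  alt≢b : ∀ k → alt k ≢ 1F
  alt≢b = alternate-≢ (λ ()) (λ ())

  alt≢d : ∀ k → alt k ≢ 3F
  alt≢d = alternate-≢ (λ ()) (λ ())

  alt-suc : ∀ k → alt k ≢ alt (suc k)
  alt-suc = alternate-suc (λ ())

  colF≢d : ∀ p → colF p ≢ 3F
  colF≢d bot ()
  colF≢d top ()
  colF≢d (f k) = alt≢d k
  colF≢d (g k) = alt≢d (suc k)

  colE≢d : ∀ p → colE p ≢ 3F
  colE≢d bot ()
  colE≢d top = alt≢d (suc n)
  colE≢d (f zero) ()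
  colE≢d (f (suc k)) ()
  colE≢d (g k) with k ≟ n
  ... | yes _ = alt≢d k
  ... | no _  = λ ()

  colF≢colF : ∀ {p q} → p ↝ q → colF p ≢ colF q
  colF≢colF bf         = λ ()
  colF≢colF (ff {k} _) = alt-suc k
  colF≢colF ft         = alt≢b n
  colF≢colF tg         = ≢-sym (alt≢b (suc n))
  colF≢colF (gg {k} _) = ≢-sym (alt-suc (suc k))
  colF≢colF gb         = λ ()

  colF≢colE : ∀ {p} → Valid p → colF p ≢ colE p
  colF≢colE {bot} _       = λ ()
  colF≢colE {top} _       = ≢-sym (alt≢b (suc n))
  colF≢colE {f zero} _    = λ ()
  colF≢colE {f (suc k)} _ = alt≢b (suc k)
  colF≢colE {g k} _ with k ≟ n
  ... | yes _ = ≢-sym (alt-suc k)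
  ... | no _  = alt≢b (suc k)

  colF≢colE′ : ∀ {p q} → p ↝ q → colF p ≢ colE q
  colF≢colE′ bf         = λ ()
  colF≢colE′ (ff {k} _) = alt≢b k
  colF≢colE′ ft         = alt-suc n
  colF≢colE′ tg with n ≟ n
  ... | yes _ = ≢-sym (alt≢b n)
  ... | no ne = contradiction refl ne
  colF≢colE′ (gg {k} lt) with k ≟ n
  ... | yes e = contradiction e (<⇒≢ lt)
  ... | no _  = alt≢b (suc (suc k))
  colF≢colE′ gb         = λ ()

  colF≢colB : ∀ i {p} → Valid p → colF p ≢ colB i p
  colF≢colB i {p} v = ≢-sym (alternate-≢ (≢-sym (colF≢colE v)) (≢-sym (colF≢d p)) i)

  colF≢colB′ : ∀ i {p q} → p ↝ q → colF p ≢ colB i q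
  colF≢colB′ i {p} x = ≢-sym (alternate-≢ (≢-sym (colF≢colE′ x)) (≢-sym (colF≢d p)) i)

  colB-S : ∀ p → colB S p ≡ 3F
  colB-S p = alternate-odd S S-odd

  data Chord : ℕ → ℕ → Fin 4 → Set where
    short : ∀ {p q x} → (∀ {r z} → NonCrossing p q r z) → Chord p q x
    rev   : ∀ {p q x} → Chord p q x → Chord q p x
    close : ∀ b {o} → o ≤ w → Chord (snake w b o) (snake w b 0) 3F
    adj   : ∀ k {o} → o ≤ w → Chord (snake w (2 + k) o) (snake w (3 + k) o) (alt k)
    inF   : ∀ i → i ≤ S → Chord (snake w 1 i) (snake w 2 i) 1F
    inG   : ∀ i → i ≤ S → Chord (snake w 1 i) (snake w 2 (suc S + i)) 0F
    out   : ∀ i → i ≤ S → Chord (snake w (2 + n) (suc S + i)) (snake w (3 + n) i) 1F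

  before : ∀ {i i'} → i ≤ S → snake w 2 i < snake w (2 + n) (suc S + i')
  before {i} {i'} v = go n
    where
    go : ∀ n → snake w 2 i < snake w (2 + n) (suc S + i')
    go zero    = +-monoʳ-< (2 * suc w) (s≤s (≤-trans v (m≤m+n S i')))
    go (suc n) = snake-< {b = 2} {3 + n} (s≤s (s≤s (s≤s z≤n))) (i≤w v)

  private
    shift : ∀ i i' → i + (suc S + i') ≡ i' + (suc S + i)
    shift i i' = eq i i' S
      where
      eq : ∀ i i' S → i + (suc S + i') ≡ i' + (suc S + i)
      eq = solve-∀
    shift′ : ∀ i i' → (suc S + i) + i' ≡ (suc S + i') + i
    shift′ i i' = trans (+-comm (suc S + i) i') (trans (shift i' i) (+-comm i (suc S + i')))

  -- Only chords starting in block 2 could interfere, and those have colour `2F`.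
  adj-inG : ∀ k {o i} → o ≤ w → i ≤ S → alt k ≡ 0F →
            NonCrossing (snake w (2 + k) o) (snake w (3 + k) o) (snake w 1 i) (snake w 2 (suc S + i))
  adj-inG zero v u ()
  adj-inG (suc k) v u _ = nc-swap (nc-far 1 (3 + k) (i≤w u) (s+i≤w u) v v (s≤s (s≤s (s≤s z≤n))))

  chord-nc : ∀ {p q r z x y} → Chord p q x → Chord r z y → x ≡ y → NonCrossing p q r z
  chord-nc (short h) _ _ = h
  chord-nc (rev c) d e = nc-flipˡ (chord-nc c d e)
  chord-nc c@(close _ _) (short h) _ = nc-swap h
  chord-nc c@(adj _ _)   (short h) _ = nc-swap h
  chord-nc c@(inF _ _)   (short h) _ = nc-swap h
  chord-nc c@(inG _ _)   (short h) _ = nc-swap h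
  chord-nc c@(out _ _)   (short h) _ = nc-swap h
  chord-nc c@(close _ _) (rev d) e = nc-flipʳ (chord-nc c d e)
  chord-nc c@(adj _ _)   (rev d) e = nc-flipʳ (chord-nc c d e)
  chord-nc c@(inF _ _)   (rev d) e = nc-flipʳ (chord-nc c d e)
  chord-nc c@(inG _ _)   (rev d) e = nc-flipʳ (chord-nc c d e)
  chord-nc c@(out _ _)   (rev d) e = nc-flipʳ (chord-nc c d e)
  chord-nc (close b v) (close b' v') _ with b ≟ b'
  ... | yes refl = nc-share
  ... | no ne = nc-blocks v z≤n v' z≤n (beyond-block ne) (beyond-block ne)
  chord-nc (close _ _) (adj k _) e = contradiction (sym e) (alt≢d k)
  chord-nc (close _ _) (inF _ _) ()
  chord-nc (close _ _) (inG _ _) ()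
  chord-nc (close _ _) (out _ _) ()
  chord-nc (adj k _) (close _ _) e = contradiction e (alt≢d k)
  chord-nc (adj k {o} v) (adj k' {o'} v') e with k ≟ k'
  ... | yes refl = nc-adjacent (2 + k) v v v' v' (+-comm o o')
  ... | no ne with parity-gap (alternate-parity (λ ()) {k} {k'} e) ne
  ...   | inj₁ lt = nc-far (2 + k) (2 + k') v v v' v' (s≤s (s≤s lt))
  ...   | inj₂ gt = nc-swap (nc-far (2 + k') (2 + k) v' v' v v (s≤s (s≤s gt)))
  chord-nc (adj k _) (inF _ _) e = contradiction e (alt≢b k)
  chord-nc (adj k v) (inG i u) e = adj-inG k v u e
  chord-nc (adj k _) (out _ _) e = contradiction e (alt≢b k)
  chord-nc (inF _ _) (close _ _) ()
  chord-nc (inF _ _) (adj k _) e = contradiction (sym e) (alt≢b k)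
  chord-nc (inF i u) (inF i' u') e = nc-adjacent 1 (i≤w u) (i≤w u) (i≤w u') (i≤w u') (+-comm i i')
  chord-nc (inF i u) (out i' u') e =
    nc-beyond {r = snake w (2 + n) (suc S + i')} {z = snake w (3 + n) i'}
      (inj₁ (snake-< {b = 1} {2 + n} {i} {suc S + i'} (s≤s (s≤s z≤n)) (i≤w u) , snake-< {b = 1} {3 + n} {i} {i'} (s≤s (s≤s z≤n)) (i≤w u)))
      (inj₁ (before u , snake-< {b = 2} {3 + n} {i} {i'} (s≤s (s≤s (s≤s z≤n))) (i≤w u)))
  chord-nc c@(inG _ _) (close _ _) ()
  chord-nc (inG i u) (adj k v) e = nc-swap (adj-inG k v u (sym e))
  chord-nc (inG i u) (inG i' u') e = nc-adjacent 1 (i≤w u) (s+i≤w u) (i≤w u') (s+i≤w u') (shift i i')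
  chord-nc c@(out _ _) (adj k _) e = contradiction (sym e) (alt≢b k)
  chord-nc c@(out _ _) d@(inF _ _) e = nc-swap (chord-nc d c (sym e))
  chord-nc (out i u) (out i' u') e = nc-adjacent (2 + n) (s+i≤w u) (i≤w u) (s+i≤w u') (i≤w u') (shift′ i i')

  open Bundle G S

  level-short : ∀ {i} p → suc i ≤ S → ∀ {r z} → NonCrossing (pos i p) (pos (suc i) p) r z
  level-short bot   lt = nc-step 1 (i≤w lt)
  level-short top   lt = nc-step (3 + n) (i≤w lt)
  level-short (f k) lt = nc-step (2 + k) (i≤w lt)
  level-short {i} (g k) lt {r} {z} =
    subst (λ o → NonCrossing (pos i (g k)) (snake w (2 + k) o) r z) (sym (+-suc (suc S) i))
      (nc-step (2 + k) (≤-trans (≤-reflexive (sym (+-suc (suc S) i))) (s+i≤w lt)))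

  chord : ∀ {i p i' q} (e : Arc i p i' q) → Chord (pos i p) (pos i' q) (colour (λ _ → colF) colB e)
  chord (fibre {i} le bf) = inF i le
  chord (fibre le (ff {k} _)) = adj k (i≤w le)
  chord (fibre le ft) = adj n (i≤w le)
  chord (fibre {i} le tg) = rev (out i le)
  chord (fibre {i} le (gg {k} _)) =
    rev (subst (Chord _ _) (sym (cong (λ b → if b then 0F else 2F) (not-involutive (odd k)))) (adj k (s+i≤w le)))
  chord (fibre {i} le gb) = rev (inG i le)
  chord (base (level {p = p} lt _)) = short (level-short p lt)
  chord (base (twist {p} x)) = subst (Chord _ _) (sym (colB-S p)) (twisted x)
    where
    twisted : ∀ {p q} → p ⋈ q → Chord (pos S p) (pos 0 q) 3F
    twisted bb = close 1 (i≤w ≤-refl)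
    twisted tt = close (3 + n) (i≤w ≤-refl)
    twisted (fg {k} _) = short λ {r} {z} →
      subst (λ o → NonCrossing (snake w (2 + k) S) (snake w (2 + k) o) r z) (cong suc (sym (+-identityʳ S)))
        (nc-step (2 + k) (m≤n+m (suc S) S))
    twisted (gf {k} _) = close (2 + k) (s+i≤w ≤-refl)

  pos-injective : ∀ {i i' p q} → i ≤ S → i' ≤ S → Valid p → Valid q → pos i p ≡ pos i' q → i ≡ i' × p ≡ q
  pos-injective {i} {i'} {p} {q} u u' v v' e with snake-injective (offset-≤ p u) (offset-≤ q u') e
  ... | eb , eo = go p q v v' eb eo
    where
    apart : ∀ {i i'} → i ≤ S → i ≢ suc S + i'
    apart {i} {i'} le = <⇒≢ (s≤s (≤-trans le (m≤m+n S i')))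
    high : ∀ {k} → k ≤ n → 2 + k ≢ 3 + n
    high le = <⇒≢ (s≤s (s≤s (s≤s le)))
    go : ∀ p q → Valid p → Valid q → block p ≡ block q → offset i p ≡ offset i' q → i ≡ i' × p ≡ q
    go bot bot _ _ _ e = e , refl
    go top top _ _ _ e = e , refl
    go top (f k) _ v b e = contradiction (sym b) (high v)
    go top (g k) _ v b e = contradiction (sym b) (high v)
    go (f k) top v _ b e = contradiction b (high v)
    go (g k) top v _ b e = contradiction b (high v)
    go (f k) (f _) _ _ refl e = e , refl
    go (g k) (g _) _ _ refl e = +-cancelˡ-≡ (suc S) _ _ e , refl
    go (f k) (g _) _ _ _ e = contradiction e (apart u)
    go (g k) (f _) _ _ _ e = contradiction (sym e) (apart u')

  layout : Layout G S 4
  layout = record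
    { pos  = pos
    ; colF = λ _ → colF
    ; colB = colB
    ; pos-injective = pos-injective
    ; ff  = λ _ → colF≢colF
    ; fb  = λ {i} _ → colF≢colB i
    ; fb′ = λ {i} _ → colF≢colB′ i
    ; bb  = λ { {i} {p} (level _ _) → colB-alternates i p
              ; {_} {p} {_} {q} (twist _) e → colE≢d q (trans (sym e) (colB-S p)) }
    ; bf  = λ { {i} (level _ v) → ≢-sym (colF≢colB i v)
              ; {_} {p} {_} {q} (twist _) e → colF≢d q (trans (sym e) (colB-S p)) }
    ; bf′ = λ { {i} (level _ _) x → ≢-sym (colF≢colB′ i x)
              ; {_} {p} {_} {_} {r} (twist _) _ e → colF≢d r (trans (sym e) (colB-S p)) }
    ; nc  = λ e f → chord-nc (chord e) (chord f)
    }
    where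
    colB-alternates : ∀ i p → colB i p ≢ colB (suc i) p
    colB-alternates i p = alternate-suc (colE≢d p) i

  -- The graph of `view` as a relation. It is functional and injective, so an image is identified by
  -- exhibiting a `Viewed` proof rather than by unfolding the comparison in `view`.
  data Viewed : ℕ → Point → Set where
    bot : Viewed 0 bot
    top : Viewed (suc (suc n)) top
    f   : ∀ {j} → j ≤ n → Viewed (suc j) (f j)
    g   : ∀ {j k} → k ≤ n → j + k ≡ T → Viewed j (g k)

  view : ℕ → Point
  view 0 = bot
  view (suc j) with <-cmp j (suc n)
  ... | tri< _ _ _ = f j
  ... | tri≈ _ _ _ = top
  ... | tri> _ _ _ = g (T ∸ suc j)

  viewed : ∀ {j} → j ≤ T → Viewed j (view j)
  viewed {0} _ = bot
  viewed {suc j} le with <-cmp j (suc n)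
  ... | tri< lt _ _   = f (s≤s⁻¹ lt)
  ... | tri≈ _ refl _ = top
  ... | tri> _ _ gt   = g (≤-trans (∸-monoʳ-≤ T (s≤s gt)) (≤-reflexive eq)) (m+[n∸m]≡n le)
    where
    eq : T ∸ (3 + n) ≡ n
    eq = trans (cong (_∸ (3 + n)) (cong suc (+-comm n (2 + n)))) (m+n∸m≡n (3 + n) n)

  late : ∀ {j k} → k ≤ n → j + k ≡ T → 2 + n < j
  late {j} {k} le e = +-cancelʳ-≤ n (3 + n) j (begin
    3 + n + n   ≡⟨ cong suc (+-comm (2 + n) n) ⟩
    T           ≡⟨ e ⟨
    j + k       ≤⟨ +-monoʳ-≤ j le ⟩
    j + n       ∎)
    where open ≤-Reasoning

  viewed-functional : ∀ {j p q} → Viewed j p → Viewed j q → p ≡ q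
  viewed-functional bot bot = refl
  viewed-functional top top = refl
  viewed-functional (f _) (f _) = refl
  viewed-functional {j} (g _ e) (g _ e') = cong g (+-cancelˡ-≡ j _ _ (trans e (sym e')))
  viewed-functional bot (g le e) = contradiction (late le e) λ ()
  viewed-functional (g le e) bot = contradiction (late le e) λ ()
  viewed-functional top (f le) = contradiction le (<⇒≱ ≤-refl)
  viewed-functional (f le) top = contradiction le (<⇒≱ ≤-refl)
  viewed-functional top (g le e) = contradiction (late le e) (<-irrefl refl)
  viewed-functional (g le e) top = contradiction (late le e) (<-irrefl refl)
  viewed-functional (f v) (g le e) = contradiction (late le e) (≤⇒≯ (s≤s (m≤n⇒m≤1+n v)))
  viewed-functional (g le e) (f v) = contradiction (late le e) (≤⇒≯ (s≤s (m≤n⇒m≤1+n v)))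

  viewed-injective : ∀ {j j' p} → Viewed j p → Viewed j' p → j ≡ j'
  viewed-injective bot bot = refl
  viewed-injective top top = refl
  viewed-injective (f _) (f _) = refl
  viewed-injective {j} {j'} (g {k = k} _ e) (g _ e') = +-cancelʳ-≡ k j j' (trans e (sym e'))

  unrolling : Unrolling T 0 G
  unrolling = record
    { view           = view
    ; view-injective = λ {j} {j'} v v' e → viewed-injective (viewed v) (subst (Viewed j') (sym e) (viewed v'))
    ; view-valid     = λ v → valid (viewed v)
    ; view-step      = λ lt → advance lt (viewed (<⇒≤ lt)) (viewed lt)
    ; view-wrap      = subst (_↝ bot) (viewed-functional (g z≤n (+-identityʳ T)) (viewed ≤-refl)) gb
    ; view-twist     = λ v v' e → twisted v v' (viewed v) (viewed v') (twist-0 v v' e)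
    }
    where
    valid : ∀ {j p} → Viewed j p → Valid p
    valid bot = _
    valid top = _
    valid (f v) = v
    valid (g v _) = v
    to : ∀ {j p q r} → p ↝ r → Viewed j r → Viewed j q → p ↝ q
    to {p = p} x v v' = subst (p ↝_) (viewed-functional v v') x
    advance : ∀ {j p q} → suc j ≤ T → Viewed j p → Viewed (suc j) q → p ↝ q
    advance lt bot = to bf (f z≤n)
    advance lt top = to tg (g ≤-refl (cong suc (+-comm (2 + n) n)))
    advance lt (f {j} v) with j ≟ n
    ... | yes refl = to ft top
    ... | no ne = to (ff (≤∧≢⇒< v ne)) (f (≤∧≢⇒< v ne))
    advance {j} lt (g {k = zero} v e) = contradiction lt (≤⇒≯ (≤-reflexive (trans (sym e) (+-identityʳ j))))
    advance {j} lt (g {k = suc k} v e) = to (gg v) (g (<⇒≤ v) (trans (sym (+-suc j k)) e))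
    twisted : ∀ {j j' p q} → j ≤ T → j' ≤ T → Viewed j p → Viewed j' q → (j ≡ 0 × j' ≡ 0) ⊎ j + j' ≡ suc T → p ⋈ q
    twisted _ _ x y (inj₁ (refl , refl)) with viewed-functional x bot | viewed-functional y bot
    ... | refl | refl = bb
    twisted _ v' bot y (inj₂ e) = contradiction (≤-reflexive (sym e)) (<⇒≱ (s≤s v'))
    twisted {j' = j'} _ _ top y (inj₂ e) = subst (top ⋈_) (viewed-functional (subst (λ j → Viewed j top) (sym eq) top) y) tt
      where
      eq : j' ≡ 2 + n
      eq = +-cancelˡ-≡ (2 + n) _ _ e
    twisted {j' = j'} _ _ (f {k} v) y (inj₂ e) =
      subst (f k ⋈_) (viewed-functional (g v (trans (+-comm j' k) (suc-injective e))) y) (fg v)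
    twisted {j} {j'} _ _ (g {k = k} v e') y (inj₂ e) =
      subst (g k ⋈_) (viewed-functional (subst (λ j → Viewed j (f k)) (sym eq) (f v)) y) (gf v)
      where
      eq : j' ≡ suc k
      eq = +-cancelˡ-≡ j _ _ (trans e (trans (cong suc (sym e')) (sym (+-suc j k))))

nc-unit : ∀ {w} b {x y r z} → x ≤ w → y ≤ w → y ≡ suc x ⊎ x ≡ suc y → NonCrossing (snake w b x) (snake w b y) r z
nc-unit b _ v (inj₁ refl) = nc-step b v
nc-unit b u _ (inj₂ refl) = nc-flipˡ (nc-step b u)

snake-unit : ∀ w b {o} → suc o ≤ w → snake w b (suc o) ≡ suc (snake w b o) ⊎ snake w b o ≡ suc (snake w b (suc o))
snake-unit w b {o} lt with odd b
... | false = inj₁ (+-suc (b * suc w) o)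
... | true  = inj₂ (trans (cong (b * suc w +_) (+-∸-assoc 1 lt)) (+-suc (b * suc w) _))

alternate-odd⁻¹ : ∀ {A : Set} {x y z : A} k → x ≢ z → alternate x y k ≡ z → odd k ≡ true
alternate-odd⁻¹ k ne e with odd k
... | true  = refl
... | false = contradiction e ne

alternate-parity′ : ∀ {A : Set} {x y z : A} → x ≢ y → x ≢ z → ∀ {k l} → alternate x y k ≡ alternate x z l → odd k ≡ odd l
alternate-parity′ ne ne' {k} {l} e with odd k | odd l
... | true  | true  = refl
... | false | false = refl
... | true  | false = contradiction (sym e) ne
... | false | true  = contradiction e ne'

-- c₀ = T, five pages, S odd.  The reflection exchanges f k with g k and, when mid holds, fixes h.
-- A block of the layout consists of the vertices over {f k , g k}, those over h being added to the
-- last one; inside a block, the vertices of each fibre are consecutive, in alternating order.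
module FivePageEven (S n : ℕ) (mid : Bool) (S-odd : odd S ≡ true) where

  half : Bool → ℕ
  half true  = suc n
  half false = n

  T : ℕ
  T = half mid + suc n

  data Point : Set where
    f g : ℕ → Point
    h   : Point

  Valid : Point → Set
  Valid (f k) = k ≤ n
  Valid (g k) = k ≤ n
  Valid h     = mid ≡ true

  data _↝_ : Point → Point → Set where
    ff : ∀ {k} → suc k ≤ n → f k ↝ f (suc k)
    gg : ∀ {k} → suc k ≤ n → g (suc k) ↝ g k
    gf : g 0 ↝ f 0
    fg : mid ≡ false → f n ↝ g n
    fh : mid ≡ true → f n ↝ h
    hg : mid ≡ true → h ↝ g n

  data _⋈_ : Point → Point → Set where
    fg : ∀ {k} → k ≤ n → f k ⋈ g k
    gf : ∀ {k} → k ≤ n → g k ⋈ f k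
    hh : mid ≡ true → h ⋈ h

  G : Fibre
  G = record { Point = Point ; Valid = Valid ; _↝_ = _↝_ ; _⋈_ = _⋈_ }

  open Bundle G S

  -- A block reserves three slots per fibre, `3 * suc S` in all, and this is the last offset. Only
  -- `h` fills a middle slot; the gaps do no harm, since only the order of positions counts.
  w : ℕ
  w = S * 3 + 2

  block slot : Point → ℕ
  block (f k) = k
  block (g k) = k
  block h     = n
  slot (f _) = 0
  slot h     = 1
  slot (g _) = 2

  inner : ℕ → ℕ → ℕ
  inner = snake 2

  pos : ℕ → Point → ℕ
  pos i p = snake w (block p) (inner i (slot p))

  0≤2 : 0 ≤ 2
  0≤2 = z≤n
  1≤2 : 1 ≤ 2
  1≤2 = s≤s z≤n

  slot-≤ : ∀ p → slot p ≤ 2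
  slot-≤ (f _) = z≤n
  slot-≤ h     = 1≤2
  slot-≤ (g _) = ≤-refl

  inner-≤ : ∀ {i o} → i ≤ S → o ≤ 2 → inner i o ≤ w
  inner-≤ {i} le o≤ = +-mono-≤ (*-monoˡ-≤ 3 le) (flip-≤ (odd i) o≤)

  reg : ℕ → Fin 5
  reg = alternate 0F 1F

  -- The arcs from `f n` to `h` and from `h` to `g n` join consecutive positions, so only properness
  -- matters. Fibre 0 is different because the twist exchanges the colours `3F` and `4F` of the base
  -- arcs arriving there.
  rungF rungH : ℕ → Fin 5
  rungF zero    = 3F
  rungF (suc _) = 4F
  rungH zero    = 4F
  rungH (suc _) = 3F

  -- As `S` is odd, fibres `0` and `S` lie in opposite orders within a block, and the twisted arcs
  -- of one block cross pairwise. They get `3F`, `4F` and, for `h`, `reg n`, which is free in the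
  -- last block when `h` is present.
  colF colB : ℕ → Point → Fin 5
  colF i (f k) with k ≟ n
  ... | yes _ = if mid then rungF i else reg k
  ... | no _  = reg k
  colF i (g k) = reg (suc k)
  colF i h     = rungH i
  colB i (f _) = alternate 2F 3F i
  colB i (g _) = alternate 2F 4F i
  colB i h     = alternate 2F (reg n) i

  reg≢ : ∀ {x : Fin 3} k → reg k ≢ Fin.suc (Fin.suc x)
  reg≢ k = alternate-≢ (λ ()) (λ ()) k

  reg-suc : ∀ k → reg k ≢ reg (suc k)
  reg-suc = alternate-suc (λ ())

  c≢reg : ∀ k → 2F ≢ reg k
  c≢reg k = ≢-sym (reg≢ k)

  colF-low : ∀ i {k} → suc k ≤ n → colF i (f k) ≡ reg k
  colF-low i {k} lt with k ≟ n
  ... | yes e = contradiction e (<⇒≢ lt)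
  ... | no _  = refl

  colF-even : ∀ i k → mid ≡ false → colF i (f k) ≡ reg k
  colF-even i k e with k ≟ n
  ... | yes _ = cong (λ b → if b then rungF i else reg k) e
  ... | no _  = refl

  colF-mid : ∀ i → mid ≡ true → colF i (f n) ≡ rungF i
  colF-mid i e with n ≟ n
  ... | yes _ = cong (λ b → if b then rungF i else reg n) e
  ... | no ne = contradiction refl ne

  colF-cases : ∀ i k → colF i (f k) ≡ reg k ⊎ colF i (f k) ≡ rungF i
  colF-cases i k with k ≟ n
  ... | no _ = inj₁ refl
  ... | yes _ = go mid
    where
    go : ∀ b → (if b then rungF i else reg k) ≡ reg k ⊎ (if b then rungF i else reg k) ≡ rungF i
    go true  = inj₂ refl
    go false = inj₁ refl

  colF-≢ : ∀ i k {x} → reg k ≢ x → rungF i ≢ x → colF i (f k) ≢ x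
  colF-≢ i k u v with colF-cases i k
  ... | inj₁ e = λ e' → u (trans (sym e) e')
  ... | inj₂ e = λ e' → v (trans (sym e) e')

  rungF≢reg : ∀ i k → rungF i ≢ reg k
  rungF≢reg zero    k = ≢-sym (reg≢ k)
  rungF≢reg (suc i) k = ≢-sym (reg≢ k)

  rungH≢reg : ∀ i k → rungH i ≢ reg k
  rungH≢reg zero    k = ≢-sym (reg≢ k)
  rungH≢reg (suc i) k = ≢-sym (reg≢ k)

  rungF≢rungH : ∀ i → rungF i ≢ rungH i
  rungF≢rungH zero    = λ ()
  rungF≢rungH (suc i) = λ ()

  reg≢colB : ∀ i k p → (p ≡ h → ⊥) → reg k ≢ colB i p
  reg≢colB i k (f _) _ = ≢-sym (alternate-≢ (≢-sym (reg≢ k)) (≢-sym (reg≢ k)) i)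
  reg≢colB i k (g _) _ = ≢-sym (alternate-≢ (≢-sym (reg≢ k)) (≢-sym (reg≢ k)) i)
  reg≢colB i k h     n = contradiction refl n

  rungF≢colB-f : ∀ i k → rungF i ≢ colB i (f k)
  rungF≢colB-f zero    k = λ ()
  rungF≢colB-f (suc i) k = ≢-sym (alternate-≢ (λ ()) (λ ()) (suc i))

  rungH≢colB-h : ∀ i → rungH i ≢ colB i h
  rungH≢colB-h zero    = λ ()
  rungH≢colB-h (suc i) = ≢-sym (alternate-≢ (λ ()) (reg≢ n) (suc i))

  rungF≢colB-h : ∀ i → rungF i ≢ colB i h
  rungF≢colB-h zero    = λ ()
  rungF≢colB-h (suc i) = ≢-sym (alternate-≢ (λ ()) (reg≢ n) (suc i))

  rungH≢colB-g : ∀ i k → rungH i ≢ colB i (g k)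
  rungH≢colB-g zero    k = λ ()
  rungH≢colB-g (suc i) k = ≢-sym (alternate-≢ (λ ()) (λ ()) (suc i))

  colF≢colF : ∀ i {p q} → p ↝ q → colF i p ≢ colF i q
  colF≢colF i (ff {k} lt) rewrite colF-low i lt = ≢-sym (colF-≢ i (suc k) (≢-sym (reg-suc k)) (rungF≢reg i k))
  colF≢colF i (gg {k} lt) = ≢-sym (reg-suc (suc k))
  colF≢colF i gf = ≢-sym (colF-≢ i 0 (λ ()) (rungF≢reg i 1))
  colF≢colF i (fg e) rewrite colF-even i n e = reg-suc n
  colF≢colF i (fh e) rewrite colF-mid i e = rungF≢rungH i
  colF≢colF i (hg e) = rungH≢reg i (suc n)

  colF≢colB : ∀ i p → colF i p ≢ colB i p
  colF≢colB i (f k) = colF-≢ i k (reg≢colB i k (f k) λ ()) (rungF≢colB-f i k)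
  colF≢colB i (g k) = reg≢colB i (suc k) (g k) λ ()
  colF≢colB i h     = rungH≢colB-h i

  colF≢colB′ : ∀ i {p q} → p ↝ q → colF i p ≢ colB i q
  colF≢colB′ i (ff {k} lt) rewrite colF-low i lt = reg≢colB i k (f (suc k)) λ ()
  colF≢colB′ i (gg {k} lt) = reg≢colB i (suc (suc k)) (g k) λ ()
  colF≢colB′ i gf = reg≢colB i 1 (f 0) λ ()
  colF≢colB′ i (fg e) rewrite colF-even i n e = reg≢colB i n (g n) λ ()
  colF≢colB′ i (fh e) rewrite colF-mid i e = rungF≢colB-h i
  colF≢colB′ i (hg e) = rungH≢colB-g i n

  topB : Point → Fin 5
  topB (f _) = 3F
  topB (g _) = 4F
  topB h     = reg n

  colB-top : ∀ p → colB S p ≡ topB p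
  colB-top (f _) = alternate-odd S S-odd
  colB-top (g _) = alternate-odd S S-odd
  colB-top h     = alternate-odd S S-odd

  c≢topB : ∀ p → 2F ≢ topB p
  c≢topB (f _) = λ ()
  c≢topB (g _) = λ ()
  c≢topB h     = c≢reg n

  colB-alternate : ∀ i p → colB i p ≡ alternate 2F (topB p) i
  colB-alternate i (f _) = refl
  colB-alternate i (g _) = refl
  colB-alternate i h     = refl

  colB≢colB : ∀ {i p i' q} → Link i p i' q → colB i p ≢ colB i' q
  colB≢colB {i} {p} (level _ _) e =
    alternate-suc (c≢topB p) i (trans (sym (colB-alternate i p)) (trans e (colB-alternate (suc i) p)))
  colB≢colB {p = p} {q = q} (twist _) e = c≢topB p (sym (trans (sym (colB-top p)) (trans e (colB-alternate 0 q))))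

  colB≢colF : ∀ {i p i' q} → Link i p i' q → colB i p ≢ colF i' q
  colB≢colF {i} {f k} (level _ _) =
    ≢-sym (colF-≢ (suc i) k (reg≢colB i k (f k) λ ()) (≢-sym (alternate-≢ (λ ()) (λ ()) i)))
  colB≢colF {i} {g k} (level _ _) = ≢-sym (reg≢colB i (suc k) (g k) λ ())
  colB≢colF {i} {h} (level _ _) = alternate-≢ (λ ()) (reg≢ n) i
  colB≢colF {p = p} (twist x) e = go x (trans (sym (colB-top p)) e)
    where
    go : ∀ {p q} → p ⋈ q → topB p ≢ colF 0 q
    go (fg {k} _) = ≢-sym (reg≢ (suc k))
    go (gf {k} _) = ≢-sym (colF-≢ 0 k (reg≢ k) λ ())
    go (hh _)     = reg≢ n

  colB≢colF′ : ∀ {i p i' q r} → Link i p i' q → r ↝ q → colB i p ≢ colF i' r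
  colB≢colF′ {i} (level _ _) (ff {k} lt) rewrite colF-low (suc i) lt = ≢-sym (reg≢colB i k (f (suc k)) λ ())
  colB≢colF′ {i} (level _ _) (gg {k} lt) = ≢-sym (reg≢colB i (suc (suc k)) (g k) λ ())
  colB≢colF′ {i} (level _ _) gf = ≢-sym (reg≢colB i 1 (f 0) λ ())
  colB≢colF′ {i} (level _ _) (fg e) rewrite colF-even (suc i) n e = ≢-sym (reg≢colB i n (g n) λ ())
  colB≢colF′ {i} (level _ _) (fh e) rewrite colF-mid (suc i) e = alternate-≢ (λ ()) (reg≢ n) i
  colB≢colF′ {i} (level _ _) (hg e) = alternate-≢ (λ ()) (λ ()) i
  colB≢colF′ {p = p} (twist x) y e = go x y (trans (sym (colB-top p)) e)
    where
    go : ∀ {p q r} → p ⋈ q → r ↝ q → topB p ≢ colF 0 r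
    go (fg _) (gg {k} _) = ≢-sym (reg≢ (suc (suc k)))
    go (fg _) (fg e) rewrite colF-even 0 n e = ≢-sym (reg≢ n)
    go (fg _) (hg _) = λ ()
    go (gf _) (ff {k} lt) rewrite colF-low 0 lt = ≢-sym (reg≢ k)
    go (gf _) gf = λ ()
    go (hh _) (fh e) rewrite colF-mid 0 e = reg≢ n

  -- Of `0F` and `1F`, the edges from the first block to the next use `reg 0`, and those reaching
  -- the last block use the one other than `reg n`; so `1F` and `reg n` are available for the arcs
  -- that stay inside these blocks.
  data Ends : ℕ → Fin 5 → Set where
    bottom : Ends 0 1F
    top    : mid ≡ false → Ends n (reg n)

  -- The base arcs out of slot o of block k have colour 2F or z; the one that wraps around enters slot o'.
  data Lane : ℕ → ℕ → ℕ → Fin 5 → Set where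
    f : ∀ k → Lane k 0 2 3F
    g : ∀ k → Lane k 2 0 4F
    h : mid ≡ true → Lane n 1 1 (reg n)

  Lane-≤ : ∀ {k o o' z} → Lane k o o' z → o ≤ 2 × o' ≤ 2
  Lane-≤ (f _) = z≤n , ≤-refl
  Lane-≤ (g _) = ≤-refl , z≤n
  Lane-≤ (h _) = 1≤2 , 1≤2

  c≢lane : ∀ {k o o' z} → Lane k o o' z → 2F ≢ z
  c≢lane (f _) = λ ()
  c≢lane (g _) = λ ()
  c≢lane (h _) = c≢reg n

  data Chord : ℕ → ℕ → Fin 5 → Set where
    short : ∀ {p q x} → (∀ {r z} → NonCrossing p q r z) → Chord p q x
    rev   : ∀ {p q x} → Chord p q x → Chord q p x
    rung  : ∀ {k x i} → Ends k x → i ≤ S → Chord (snake w k (inner i 0)) (snake w k (inner i 2)) x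
    adj   : ∀ {k y} → suc k ≤ n → y ≤ w → Chord (snake w k y) (snake w (suc k) y) (reg k)
    strip : ∀ {k o o' z i} → Lane k o o' z → suc i ≤ S →
            Chord (snake w k (inner i o)) (snake w k (inner (suc i) o)) (alternate 2F z i)
    wrap  : ∀ {k o o' z} → Lane k o o' z → Chord (snake w k (inner S o)) (snake w k (inner 0 o')) z

  reg-is-b : ∀ {k} → 1F ≡ reg k → k ≢ 0
  reg-is-b () refl

  ends≢c : ∀ {k x} → Ends k x → x ≢ 2F
  ends≢c bottom   = λ ()
  ends≢c (top _)  = reg≢ n

  rung-adj : ∀ {k x k'} → Ends k x → x ≡ reg k' → suc k' ≤ n → k' ≢ k × suc k' ≢ k
  rung-adj bottom e lt = reg-is-b e , λ ()
  rung-adj {k' = k'} (top _) e lt = <⇒≢ lt , λ e' → reg-suc k' (trans (sym e) (cong reg (sym e')))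

  rung-lane : ∀ {k x k' o o' z} → Ends k x → Lane k' o o' z → x ≡ z → k' ≢ k
  rung-lane bottom  (f _)  ()
  rung-lane bottom  (g _)  ()
  rung-lane bottom  (h _)  e = reg-is-b e
  rung-lane (top _) (f _)  e = contradiction e (reg≢ n)
  rung-lane (top _) (g _)  e = contradiction e (reg≢ n)
  rung-lane (top m) (h m') _ = contradiction (trans (sym m) m') λ ()

  adj-lane : ∀ {k k' o o' z} → suc k ≤ n → Lane k' o o' z → reg k ≡ z → k ≢ k' × suc k ≢ k'
  adj-lane {k} lt (f _) e = contradiction e (reg≢ k)
  adj-lane {k} lt (g _) e = contradiction e (reg≢ k)
  adj-lane {k} lt (h _) e = <⇒≢ lt , λ e' → reg-suc k (trans e (cong reg (sym e')))

  nc-block≢ : ∀ {k k' x y u v} → x ≤ w → y ≤ w → u ≤ w → v ≤ w → k ≢ k' →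
              NonCrossing (snake w k x) (snake w k y) (snake w k' u) (snake w k' v)
  nc-block≢ x≤ y≤ u≤ v≤ ne = nc-blocks x≤ y≤ u≤ v≤ (beyond-block ne) (beyond-block ne)

  rung-rung : ∀ k k' {i i'} → i ≤ S → i' ≤ S →
              NonCrossing (snake w k (inner i 0)) (snake w k (inner i 2)) (snake w k' (inner i' 0)) (snake w k' (inner i' 2))
  rung-rung k k' {i} {i'} u u' with k ≟ k' | i ≟ i'
  ... | no ne    | _        = nc-block≢ (inner-≤ u 0≤2) (inner-≤ u ≤-refl) (inner-≤ u' 0≤2) (inner-≤ u' ≤-refl) ne
  ... | yes refl | yes refl = nc-sum {p = snake w k (inner i 0)} refl
  ... | yes refl | no ne    = nc-snake k (nc-blocks {b = i} {i} {i'} {i'} 0≤2 ≤-refl 0≤2 ≤-refl (beyond-block ne) (beyond-block ne))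

  adj-adj : ∀ k k' {y y'} → y ≤ w → y' ≤ w → reg k ≡ reg k' →
            NonCrossing (snake w k y) (snake w (suc k) y) (snake w k' y') (snake w (suc k') y')
  adj-adj k k' {y} {y'} v v' e with k ≟ k'
  ... | yes refl = nc-adjacent k v v v' v' (+-comm y y')
  ... | no ne with parity-gap (alternate-parity (λ ()) {k} {k'} e) ne
  ...   | inj₁ lt = nc-far k k' v v v' v' lt
  ...   | inj₂ gt = nc-swap (nc-far k' k v' v' v v gt)

  adj-block : ∀ {k k' y u v} → y ≤ w → u ≤ w → v ≤ w → k ≢ k' × suc k ≢ k' →
              NonCrossing (snake w k y) (snake w (suc k) y) (snake w k' u) (snake w k' v)
  adj-block y≤ u≤ v≤ (ne , ne') = nc-blocks y≤ y≤ u≤ v≤ (beyond-block ne) (beyond-block ne')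

  strip-strip : ∀ {k k' o o' l l' z z' i i'} → Lane k o l z → Lane k' o' l' z' → suc i ≤ S → suc i' ≤ S →
                alternate 2F z i ≡ alternate 2F z' i' →
                NonCrossing (snake w k (inner i o)) (snake w k (inner (suc i) o)) (snake w k' (inner i' o')) (snake w k' (inner (suc i') o'))
  strip-strip {k} {k'} {o} {o'} {i = i} {i'} L L' lt lt' e with k ≟ k' | i ≟ i'
  ... | no ne    | _        = nc-block≢ (inner-≤ (<⇒≤ lt) u) (inner-≤ lt u) (inner-≤ (<⇒≤ lt') u') (inner-≤ lt' u') ne
    where u = proj₁ (Lane-≤ L) ; u' = proj₁ (Lane-≤ L')
  ... | yes refl | yes refl = nc-snake k (nc-adjacent i u u u' u' (+-comm o o'))
    where u = proj₁ (Lane-≤ L) ; u' = proj₁ (Lane-≤ L')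
  ... | yes refl | no ne with parity-gap (alternate-parity′ (c≢lane L) (c≢lane L') {i} {i'} e) ne
  ...   | inj₁ far = nc-snake k (nc-far i i' u u u' u' far)
    where u = proj₁ (Lane-≤ L) ; u' = proj₁ (Lane-≤ L')
  ...   | inj₂ far = nc-swap (nc-snake k (nc-far i' i u' u' u u far))
    where u = proj₁ (Lane-≤ L) ; u' = proj₁ (Lane-≤ L')

  strip-wrap : ∀ {k k' o o' l l' z z' i} → Lane k o l z → Lane k' o' l' z' → suc i ≤ S → alternate 2F z i ≡ z' →
               NonCrossing (snake w k (inner i o)) (snake w k (inner (suc i) o)) (snake w k' (inner S o')) (snake w k' (inner 0 l'))
  strip-wrap {k} {k'} {i = i} L L' lt e with k ≟ k' | Lane-≤ L | Lane-≤ L'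
  ... | no ne    | u , _ | v , v' = nc-block≢ (inner-≤ (<⇒≤ lt) u) (inner-≤ lt u) (inner-≤ ≤-refl v) (inner-≤ z≤n v') ne
  ... | yes refl | u , _ | v , v' =
    -- The colour is not `2F`, so `i` is odd like `S`. Hence fibres `i` and `suc i` lie strictly
    -- between the fibres `0` and `S` joined by the twisted arc.
    nc-snake k (nc-swap (nc-blocks {b = S} {0} {i} {suc i} v v' u u (inj₂ (lt , lt')) (inj₁ (0<i i i-odd , s≤s z≤n))))
    where
    i-odd : odd i ≡ true
    i-odd = alternate-odd⁻¹ i (c≢lane L') e
    0<i : ∀ i → odd i ≡ true → 0 < i
    0<i (suc i) _ = s≤s z≤n
    lt' : suc i < S
    lt' = ≤∧≢⇒< lt λ e → contradiction (trans (sym (cong not i-odd)) (trans (cong odd e) S-odd)) λ ()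

  wrap-wrap : ∀ {k k' o o' l l' z z'} → Lane k o l z → Lane k' o' l' z' → z ≡ z' →
              NonCrossing (snake w k (inner S o)) (snake w k (inner 0 l)) (snake w k' (inner S o')) (snake w k' (inner 0 l'))
  wrap-wrap {k} {k'} L L' e with k ≟ k'
  ... | no ne = nc-block≢ (inner-≤ ≤-refl (proj₁ (Lane-≤ L))) (inner-≤ z≤n (proj₂ (Lane-≤ L)))
                          (inner-≤ ≤-refl (proj₁ (Lane-≤ L'))) (inner-≤ z≤n (proj₂ (Lane-≤ L'))) ne
  wrap-wrap (f k) (f _) e | yes refl = nc-sum {p = snake w k (inner S 0)} refl
  wrap-wrap (g k) (g _) e | yes refl = nc-sum {p = snake w k (inner S 2)} refl
  wrap-wrap (h _) (h _) e | yes refl = nc-sum {p = snake w n (inner S 1)} refl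
  wrap-wrap (f _) (h _) e | yes refl = contradiction (sym e) (reg≢ n)
  wrap-wrap (g _) (h _) e | yes refl = contradiction (sym e) (reg≢ n)
  wrap-wrap (h _) (f _) e | yes refl = contradiction e (reg≢ n)
  wrap-wrap (h _) (g _) e | yes refl = contradiction e (reg≢ n)

  alternate-lane : ∀ {z} i {x : Fin 5} → x ≢ 2F → x ≡ alternate 2F z i → x ≡ z
  alternate-lane i ne e with odd i
  ... | true  = e
  ... | false = contradiction e ne

  lane-chord : ∀ {p q r z x y} → Chord p q x → Chord r z y → x ≡ y → NonCrossing p q r z
  lane-chord (short u) _ _ = u
  lane-chord (rev c) d e = nc-flipˡ (lane-chord c d e)
  lane-chord (rung _ _)  (short u) _ = nc-swap u
  lane-chord (adj _ _)   (short u) _ = nc-swap u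
  lane-chord (strip _ _) (short u) _ = nc-swap u
  lane-chord (wrap _)    (short u) _ = nc-swap u
  lane-chord c@(rung _ _)  (rev d) e = nc-flipʳ (lane-chord c d e)
  lane-chord c@(adj _ _)   (rev d) e = nc-flipʳ (lane-chord c d e)
  lane-chord c@(strip _ _) (rev d) e = nc-flipʳ (lane-chord c d e)
  lane-chord c@(wrap _)    (rev d) e = nc-flipʳ (lane-chord c d e)
  lane-chord (rung {k} _ u) (rung {k'} _ u') _ = rung-rung k k' u u'
  lane-chord (rung E u) (adj lt v) e =
    nc-swap (adj-block v (inner-≤ u 0≤2) (inner-≤ u ≤-refl) (rung-adj E e lt))
  lane-chord (rung E u) (strip {i = i} L lt) e =
    nc-swap (nc-block≢ (inner-≤ (<⇒≤ lt) (proj₁ (Lane-≤ L))) (inner-≤ lt (proj₁ (Lane-≤ L)))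
                       (inner-≤ u 0≤2) (inner-≤ u ≤-refl) (rung-lane E L (alternate-lane i (ends≢c E) e)))
  lane-chord (rung E u) (wrap L) e =
    nc-swap (nc-block≢ (inner-≤ ≤-refl (proj₁ (Lane-≤ L))) (inner-≤ z≤n (proj₂ (Lane-≤ L)))
                       (inner-≤ u 0≤2) (inner-≤ u ≤-refl) (rung-lane E L e))
  lane-chord c@(adj _ _) d@(rung _ _) e = nc-swap (lane-chord d c (sym e))
  lane-chord (adj {k} _ v) (adj {k'} _ v') e = adj-adj k k' v v' e
  lane-chord (adj {k} lt v) (strip {i = i} L lt') e =
    adj-block v (inner-≤ (<⇒≤ lt') (proj₁ (Lane-≤ L))) (inner-≤ lt' (proj₁ (Lane-≤ L)))
              (adj-lane lt L (alternate-lane i (reg≢ k) e))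
  lane-chord (adj lt v) (wrap L) e =
    adj-block v (inner-≤ ≤-refl (proj₁ (Lane-≤ L))) (inner-≤ z≤n (proj₂ (Lane-≤ L))) (adj-lane lt L e)
  lane-chord c@(strip _ _) d@(rung _ _) e = nc-swap (lane-chord d c (sym e))
  lane-chord c@(strip _ _) d@(adj _ _)  e = nc-swap (lane-chord d c (sym e))
  lane-chord (strip L lt) (strip L' lt') e = strip-strip L L' lt lt' e
  lane-chord (strip L lt) (wrap L') e = strip-wrap L L' lt e
  lane-chord c@(wrap _) d@(rung _ _)  e = nc-swap (lane-chord d c (sym e))
  lane-chord c@(wrap _) d@(adj _ _)   e = nc-swap (lane-chord d c (sym e))
  lane-chord c@(wrap _) d@(strip _ _) e = nc-swap (lane-chord d c (sym e))
  lane-chord (wrap L) (wrap L') e = wrap-wrap L L' e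

  chord : ∀ {i p i' q} (e : Arc i p i' q) → Chord (pos i p) (pos i' q) (colour colF colB e)
  chord (fibre {i} le (ff lt)) = subst (Chord _ _) (sym (colF-low i lt)) (adj lt (inner-≤ le 0≤2))
  chord (fibre le (gg {k} lt)) =
    rev (subst (Chord _ _) (sym (cong (λ b → if b then 1F else 0F) (not-involutive (odd k)))) (adj lt (inner-≤ le ≤-refl)))
  chord (fibre le gf) = rev (rung bottom le)
  chord (fibre {i} le (fg e)) = subst (Chord _ _) (sym (colF-even i n e)) (rung (top e) le)
  chord (fibre {i} le (fh e)) = short (nc-unit n (inner-≤ le 0≤2) (inner-≤ le 1≤2) (snake-unit 2 i 1≤2))
  chord (fibre {i} le (hg e)) = short (nc-unit n (inner-≤ le 1≤2) (inner-≤ le ≤-refl) (snake-unit 2 i ≤-refl))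
  chord (base (level {p = f k} lt _)) = strip (f k) lt
  chord (base (level {p = g k} lt _)) = strip (g k) lt
  chord (base (level {p = h} lt e))   = strip (h e) lt
  chord (base (twist (fg {k} _)))     = subst (Chord _ _) (sym (colB-top (f k))) (wrap (f k))
  chord (base (twist (gf {k} _)))     = subst (Chord _ _) (sym (colB-top (g k))) (wrap (g k))
  chord (base (twist (hh e)))         = subst (Chord _ _) (sym (colB-top h)) (wrap (h e))

  pos-injective : ∀ {i i' p q} → i ≤ S → i' ≤ S → pos i p ≡ pos i' q → i ≡ i' × p ≡ q
  pos-injective {i} {i'} {p} {q} u u' e with snake-injective (inner-≤ u (slot-≤ p)) (inner-≤ u' (slot-≤ q)) e
  ... | eb , eo with snake-injective {b = i} {i'} (slot-≤ p) (slot-≤ q) eo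
  ...   | ei , es = ei , go p q eb es
    where
    go : ∀ p q → block p ≡ block q → slot p ≡ slot q → p ≡ q
    go (f _) (f _) refl _ = refl
    go (g _) (g _) refl _ = refl
    go h h _ _ = refl

  layout : Layout G S 5
  layout = record
    { pos  = pos
    ; colF = colF
    ; colB = colB
    ; pos-injective = λ u u' _ _ → pos-injective u u'
    ; ff  = λ {i} _ → colF≢colF i
    ; fb  = λ {i} {p} _ _ → colF≢colB i p
    ; fb′ = λ {i} _ → colF≢colB′ i
    ; bb  = colB≢colB
    ; bf  = colB≢colF
    ; bf′ = colB≢colF′
    ; nc  = λ e f → lane-chord (chord e) (chord f)
    }

  data Viewed : ℕ → Point → Set where
    f : ∀ {j} → j ≤ n → Viewed j (f j)
    h : mid ≡ true → Viewed (suc n) h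
    g : ∀ {j k} → k ≤ n → j + k ≡ T → Viewed j (g k)

  view : ℕ → Point
  view j with j ≤? n | T ∸ j ≤? n
  ... | yes _ | _     = f j
  ... | no _  | yes _ = g (T ∸ j)
  ... | no _  | no _  = h

  viewed : ∀ {j} → j ≤ T → Viewed j (view j)
  viewed {j} le with j ≤? n | T ∸ j ≤? n
  ... | yes u | _     = f u
  ... | no _  | yes v = g v (m+[n∸m]≡n le)
  ... | no u  | no v  = subst (λ j → Viewed j h) (sym (proj₂ middle)) (h (proj₁ middle))
    where
    lemma : ∀ m → j ≤ half m + suc n → ¬ (half m + suc n ∸ j ≤ n) → m ≡ true × j ≡ suc n
    lemma true le v = refl , ≤-antisym
      (+-cancelʳ-≤ (suc n) j (suc n) (≤-trans (+-monoʳ-≤ j (≰⇒> v)) (≤-reflexive (m+[n∸m]≡n le)))) (≰⇒> u)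
    lemma false le v = contradiction (≤-trans (∸-monoʳ-≤ (n + suc n) (≰⇒> u)) (≤-reflexive (m+n∸n≡m n (suc n)))) v
    middle = lemma mid le v

  n≤half : ∀ m → n ≤ half m
  n≤half true  = n≤1+n n
  n≤half false = ≤-refl

  late : ∀ {j k} → k ≤ n → j + k ≡ T → half mid < j
  late {j} {k} le e = +-cancelʳ-≤ n (suc (half mid)) j (begin
    suc (half mid) + n  ≡⟨ +-suc (half mid) n ⟨
    T                   ≡⟨ e ⟨
    j + k               ≤⟨ +-monoʳ-≤ j le ⟩
    j + n               ∎)
    where open ≤-Reasoning

  viewed-functional : ∀ {j p q} → Viewed j p → Viewed j q → p ≡ q
  viewed-functional (f _) (f _) = refl
  viewed-functional (h _) (h _) = refl
  viewed-functional {j} (g _ e) (g _ e') = cong g (+-cancelˡ-≡ j _ _ (trans e (sym e')))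
  viewed-functional (f v) (h _) = contradiction v (<⇒≱ ≤-refl)
  viewed-functional (h _) (f v) = contradiction v (<⇒≱ ≤-refl)
  viewed-functional (f v) (g le e) = contradiction (late le e) (≤⇒≯ (≤-trans v (n≤half mid)))
  viewed-functional (g le e) (f v) = contradiction (late le e) (≤⇒≯ (≤-trans v (n≤half mid)))
  viewed-functional (h m) (g le e) = contradiction (late le e) (<-irrefl (cong half m))
  viewed-functional (g le e) (h m) = contradiction (late le e) (<-irrefl (cong half m))

  viewed-injective : ∀ {j j' p} → Viewed j p → Viewed j' p → j ≡ j'
  viewed-injective (f _) (f _) = refl
  viewed-injective (h _) (h _) = refl
  viewed-injective {j} {j'} (g {k = k} _ e) (g _ e') = +-cancelʳ-≡ k j j' (trans e (sym e'))

  unrolling : Unrolling T T G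
  unrolling = record
    { view           = view
    ; view-injective = λ {j} {j'} v v' e → viewed-injective (viewed v) (subst (Viewed j') (sym e) (viewed v'))
    ; view-valid     = λ v → valid (viewed v)
    ; view-step      = λ lt → advance lt (viewed (<⇒≤ lt)) (viewed lt)
    ; view-wrap      = subst₂ _↝_ (viewed-functional (g z≤n (+-identityʳ T)) (viewed ≤-refl))
                                  (viewed-functional (f z≤n) (viewed z≤n)) gf
    ; view-twist     = λ v v' e → twisted (viewed v) (viewed v') (twist-T v v' e)
    }
    where
    valid : ∀ {j p} → Viewed j p → Valid p
    valid (f v) = v
    valid (h e) = e
    valid (g v _) = v
    to : ∀ {j p q r} → p ↝ r → Viewed j r → Viewed j q → p ↝ q
    to {p = p} x v v' = subst (p ↝_) (viewed-functional v v') x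
    T-even : mid ≡ false → suc n + n ≡ T
    T-even e = trans (sym (+-suc n n)) (cong (λ m → half m + suc n) (sym e))
    T-mid : mid ≡ true → suc n + suc n ≡ T
    T-mid e = cong (λ m → half m + suc n) (sym e)
    advance : ∀ {j p q} → suc j ≤ T → Viewed j p → Viewed (suc j) q → p ↝ q
    advance lt (f {j} v) with j ≟ n
    ... | no ne    = to (ff (≤∧≢⇒< v ne)) (f (≤∧≢⇒< v ne))
    ... | yes refl = go mid refl
      where
      go : ∀ {q} m → mid ≡ m → Viewed (suc n) q → f n ↝ q
      go true  m = to (fh m) (h m)
      go false m = to (fg m) (g ≤-refl (T-even m))
    advance lt (h m) = to (hg m) (g ≤-refl (trans (cong suc (sym (+-suc n n))) (T-mid m)))
    advance {j} lt (g {k = zero} v e) = contradiction lt (≤⇒≯ (≤-reflexive (trans (sym e) (+-identityʳ j))))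
    advance {j} lt (g {k = suc k} v e) = to (gg v) (g (<⇒≤ v) (trans (sym (+-suc j k)) e))
    twisted : ∀ {j j' p q} → Viewed j p → Viewed j' q → j + j' ≡ T → p ⋈ q
    twisted {j' = j'} (f {k} v) y e = subst (f k ⋈_) (viewed-functional (g v (trans (+-comm j' k) e)) y) (fg v)
    twisted {j} (g {k = k} v e') y e =
      subst (g k ⋈_) (viewed-functional (subst (λ j → Viewed j (f k)) (+-cancelˡ-≡ j _ _ (trans e' (sym e))) (f v)) y) (gf v)
    twisted (h m) y e =
      subst (h ⋈_) (viewed-functional (subst (λ j → Viewed j h) (+-cancelˡ-≡ (suc n) _ _ (trans (T-mid m) (sym e))) (h m)) y) (hh m)

-- Lower bounds

open Sum (CommutativeRing.+-commutativeMonoid xor-∧-commutativeRing)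
  using (sum; sum-cong-≗; sum-permute; ∑-distrib-+; sum-replicate-zero)

-- Punching out a missed value would leave an injection of `Fin (suc n)` into `Fin n`.
injective⇒surjective : ∀ {n} {f : Fin n → Fin n} → Injective _≡_ _≡_ f → ∀ y → ∃ λ x → f x ≡ y
injective⇒surjective {suc n} {f} inj y with Fin.any? (λ x → f x Fin.≟ y)
... | yes p = p
... | no ¬p = contradiction (Fin.injective⇒≤ punched-injective) (<⇒≱ ≤-refl)
  where
  avoids : ∀ x → y ≢ f x
  avoids x e = ¬p (x , sym e)
  punched-injective : Injective _≡_ _≡_ λ x → Fin.punchOut (avoids x)
  punched-injective {x} {x'} e = inj (Fin.punchOut-injective (avoids x) (avoids x') e)

-- Addition is `_xor_`, so the `sum` of a predicate is the parity of the number of elements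
-- satisfying it.
sum-δ : ∀ {n} (a : Fin n) → sum (λ x → does (x Fin.≟ a)) ≡ true
sum-δ {suc n} Fin.zero    = cong not (sum-replicate-zero n)
sum-δ {suc n} (Fin.suc a) = trans
  (sum-cong-≗ {n} λ x → does-⇔ (mk⇔ Fin.suc-injective (cong Fin.suc)) (Fin.suc x Fin.≟ Fin.suc a) (x Fin.≟ a))
  (sum-δ a)

-- A fixed-point-free involution pairs off the elements of any invariant subset.
sum-involution : ∀ {n} (μ : Fin n → Fin n) → (∀ x → μ (μ x) ≡ x) → (∀ x → μ x ≢ x) →
                 (P : Fin n → Bool) → (∀ x → P (μ x) ≡ P x) → sum P ≡ false
sum-involution μ invol free P inv = begin
  sum P                                      ≡⟨ sum-cong-≗ split ⟩
  sum (λ x → g x xor g (μ x))                ≡⟨ ∑-distrib-+ g (g ∘ μ) ⟩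
  sum g xor sum (g ∘ μ)                      ≡⟨ cong (sum g xor_) (sum-permute g (permutation μ μ invol invol)) ⟨
  sum g xor sum g                            ≡⟨ xor-same (sum g) ⟩
  false                                      ∎
  where
  open ≡-Reasoning
  g : Fin _ → Bool
  -- This selects the smaller element of each pair; the larger ones are selected by `g ∘ μ`, and `μ`
  -- matches the two halves.
  g x = P x ∧ does (x Fin.<? μ x)
  orient : ∀ p x → p ≡ (p ∧ does (x Fin.<? μ x)) xor (p ∧ does (μ x Fin.<? x))
  orient false x = refl
  orient true  x with Fin.<-cmp x (μ x)
  ... | tri< a _ c rewrite dec-true (x Fin.<? μ x) a | dec-false (μ x Fin.<? x) c = refl
  ... | tri≈ _ b _ = contradiction (sym b) (free x)
  ... | tri> a _ c rewrite dec-false (x Fin.<? μ x) a | dec-true (μ x Fin.<? x) c = refl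
  split : ∀ x → P x ≡ g x xor g (μ x)
  split x = subst₂ (λ p y → P x ≡ g x xor (p ∧ does (μ x Fin.<? y))) (sym (inv x)) (sym (invol x)) (orient (P x) x)

module Regular {V : Set} {Adj : V → V → Set} {d : ℕ} (_≟V_ : DecidableEquality V)
               (adj-sym : ∀ {u v} → Adj u v → Adj v u) (adj-irrefl : ∀ {u} → ¬ Adj u u)
               (nb : V → Fin d → V) (nb-adj : ∀ u k → Adj u (nb u k))
               (nb-injective : ∀ u → Injective _≡_ _≡_ (nb u)) where

  module _ {m : ℕ} (E : MatchingBookEmbedding V Adj m) where
    open MatchingBookEmbedding E

    nb-colours : ∀ u → Injective _≡_ _≡_ λ k → col u (nb u k)
    nb-colours u {k} {l} e with k Fin.≟ l
    ... | yes p = p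
    ... | no ne = contradiction e (proper u (nb u k) (nb u l) (nb-adj u k) (nb-adj u l) (ne ∘ nb-injective u))

    degree≤pages : V → d ≤ m
    degree≤pages u = Fin.injective⇒≤ (nb-colours u)

    same-colour : ∀ {u v v'} → Adj u v → Adj u v' → col u v ≡ col u v' → v ≡ v'
    same-colour {u} {v} {v'} a a' e with v ≟V v'
    ... | yes p = p
    ... | no ne = contradiction e (proper u v v' a a' ne)

  -- Every page is a perfect matching, so the vertices under one of its edges are matched
  -- among themselves and their number is even: adjacent vertices have ranks of opposite parity.
  bipartite : ∀ {N} → V ↔ Fin N → MatchingBookEmbedding V Adj d → Bipartite V Adj
  bipartite {N} enc E = rank , λ u v → rank-≢ u v
    where
    open MatchingBookEmbedding E
    open Inverse enc using (to; from)
    open ≡-Reasoning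

    to-from : ∀ x → to (from x) ≡ x
    to-from x = Inverse.inverseˡ enc refl
    from-to : ∀ v → from (to v) ≡ v
    from-to v = Inverse.inverseʳ enc refl

    module Page (k : Fin d) where
      slot : V → Fin d
      slot u = proj₁ (injective⇒surjective (nb-colours E u) k)

      mate : V → V
      mate u = nb u (slot u)

      mate-adj : ∀ u → Adj u (mate u)
      mate-adj u = nb-adj u (slot u)

      mate-col : ∀ u → col u (mate u) ≡ k
      mate-col u = proj₂ (injective⇒surjective (nb-colours E u) k)

      mate-free : ∀ u → mate u ≢ u
      mate-free u e = adj-irrefl (subst (Adj u) e (mate-adj u))

      mate-unique : ∀ {u v} → Adj u v → col u v ≡ k → mate u ≡ v
      mate-unique {u} a e = same-colour E (mate-adj u) a (trans (mate-col u) (sym e))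

      mate-involutive : ∀ u → mate (mate u) ≡ u
      mate-involutive u = mate-unique (adj-sym (mate-adj u)) (trans (sym (col-sym u (mate u) (mate-adj u))) (mate-col u))

    -- The parity of the number of vertices before `a`. The parity of `pos a` itself would not do,
    -- since positions may leave gaps.
    rank : V → Bool
    rank a = sum λ x → does (pos (from x) <? pos a)

    module Edge {a b : V} (ab : Adj a b) (a<b : pos a < pos b) where
      open Page (col a b)

      between? : ∀ v → Dec (pos a < pos v × pos v < pos b)
      between? v = (pos a <? pos v) ×-dec (pos v <? pos b)

      mate-a : mate a ≡ b
      mate-a = mate-unique ab refl

      mate-b : mate b ≡ a
      mate-b = trans (cong mate (sym mate-a)) (mate-involutive a)

      -- The edge from `v` to `mate v` lies on the page of the edge from `a` to `b`, so it cannot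
      -- cross that edge; nor can it end in `a` or `b`, which are matched with each other.
      mate-between : ∀ v → pos a < pos v × pos v < pos b → pos a < pos (mate v) × pos (mate v) < pos b
      mate-between v (l , r) = left , right
        where
        back : mate (mate v) ≡ v
        back = mate-involutive v
        v≢ : ∀ {x} → mate v ≡ x → v ≡ mate x
        v≢ e = trans (sym back) (cong mate e)
        left : pos a < pos (mate v)
        left with <-cmp (pos a) (pos (mate v))
        ... | tri< lt _ _ = lt
        ... | tri≈ _ e _  = contradiction (cong pos (trans (v≢ (sym (pos-inj e))) mate-a)) (<⇒≢ r)
        ... | tri> _ _ gt = contradiction (trans (sym (col-sym v (mate v) (mate-adj v))) (mate-col v))
                              (noCross (mate v) v a b (adj-sym (mate-adj v)) ab gt l r)
        right : pos (mate v) < pos b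
        right with <-cmp (pos (mate v)) (pos b)
        ... | tri< lt _ _ = lt
        ... | tri≈ _ e _  = contradiction (cong pos (sym (trans (v≢ (pos-inj e)) mate-b))) (<⇒≢ l)
        ... | tri> _ _ gt = contradiction (sym (mate-col v)) (noCross a b v (mate v) ab (mate-adj v) l r gt)

      between-even : sum (λ x → does (between? (from x))) ≡ false
      between-even = sum-involution (to ∘ mate ∘ from)
        (λ x → trans (cong (to ∘ mate) (from-to _)) (trans (cong to (mate-involutive (from x))) (to-from x)))
        (λ x e → mate-free (from x) (trans (sym (from-to _)) (cong from e)))
        (λ x → does (between? (from x)))
        (λ x → trans (cong (does ∘ between?) (from-to (mate (from x))))
                 (does-⇔ (mk⇔ (λ i → subst (λ v → pos a < pos v × pos v < pos b) (mate-involutive (from x)) (mate-between _ i))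
                              (mate-between (from x)))
                         (between? (mate (from x))) (between? (from x))))

      -- Before `b` come the vertices before `a`, then `a` itself, then those between, whose number
      -- is even; so the rank changes parity from `a` to `b`.
      split : ∀ v → does (pos v <? pos b) ≡ does (pos v <? pos a) xor (does (to v Fin.≟ to a) xor does (between? v))
      split v with <-cmp (pos v) (pos a)
      ... | tri< lt ne _ rewrite dec-true (pos v <? pos b) (<-trans lt a<b) | dec-true (pos v <? pos a) lt
            | dec-false (to v Fin.≟ to a) (λ e → ne (cong pos (trans (sym (from-to v)) (trans (cong from e) (from-to a)))))
            | dec-false (pos a <? pos v) (<-asym lt) = refl
      ... | tri≈ ¬lt e ¬gt rewrite dec-true (pos v <? pos b) (subst (_< pos b) (sym e) a<b) | dec-false (pos v <? pos a) ¬lt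
            | dec-true (to v Fin.≟ to a) (cong to (pos-inj e)) | dec-false (pos a <? pos v) ¬gt = refl
      ... | tri> ¬lt ne gt rewrite dec-false (pos v <? pos a) ¬lt
            | dec-false (to v Fin.≟ to a) (λ e → ne (cong pos (trans (sym (from-to v)) (trans (cong from e) (from-to a)))))
            | dec-true (pos a <? pos v) gt = refl

      rank-flips : rank b ≡ not (rank a)
      rank-flips = begin
        rank b                                            ≡⟨ sum-cong-≗ (split ∘ from) ⟩
        sum (λ x → before x xor (at x xor amid x))        ≡⟨ ∑-distrib-+ before (λ x → at x xor amid x) ⟩
        rank a xor sum (λ x → at x xor amid x)            ≡⟨ cong (rank a xor_) (∑-distrib-+ at amid) ⟩
        rank a xor (sum at xor sum amid)                  ≡⟨ cong₂ (λ p q → rank a xor (p xor q)) sum-at between-even ⟩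
        rank a xor true                                   ≡⟨ xor-comm (rank a) true ⟩
        not (rank a)                                      ∎
        where
        before at amid : Fin N → Bool
        before x = does (pos (from x) <? pos a)
        at x     = does (to (from x) Fin.≟ to a)
        amid x   = does (between? (from x))
        sum-at : sum at ≡ true
        sum-at = trans (sum-cong-≗ λ x → cong (λ y → does (y Fin.≟ to a)) (to-from x)) (sum-δ (to a))

    rank-≢ : ∀ u v → Adj u v → rank u ≢ rank v
    rank-≢ u v a with <-cmp (pos u) (pos v)
    ... | tri< lt _ _ = λ e → not-¬ (sym e) (Edge.rank-flips a lt)
    ... | tri≈ _ e _  = contradiction (subst (Adj u) (sym (pos-inj e)) a) adj-irrefl
    ... | tri> _ _ gt = λ e → not-¬ e (Edge.rank-flips (adj-sym a) gt)

-- -- Bipartiteness by parities and choice of the layout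

alternating : ∀ {n} (h : Fin (suc n) → Bool) → (∀ j j' → toℕ j' ≡ suc (toℕ j) → h j ≢ h j') →
              ∀ j → h j ≡ h Fin.zero xor odd (toℕ j)
alternating h alt = <-weakInduction _ (sym (xor-identityʳ _)) λ i ih → begin
  h (Fin.suc i)                                    ≡⟨ ¬-not (alt (Fin.inject₁ i) (Fin.suc i) (cong suc (sym (Fin.toℕ-inject₁ i))) ∘ sym) ⟩
  not (h (Fin.inject₁ i))                          ≡⟨ cong not ih ⟩
  not (h Fin.zero xor odd (toℕ (Fin.inject₁ i)))   ≡⟨ not-distribʳ-xor (h Fin.zero) _ ⟩
  h Fin.zero xor not (odd (toℕ (Fin.inject₁ i)))   ≡⟨ cong (λ k → h Fin.zero xor not (odd k)) (Fin.toℕ-inject₁ i) ⟩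
  h Fin.zero xor odd (toℕ (Fin.suc i))             ∎
  where open ≡-Reasoning

xor-moves : ∀ {x y} → x ≢ x xor y → y ≡ true
xor-moves {x} {true}  _  = refl
xor-moves {x} {false} ne = contradiction (sym (xor-identityʳ x)) ne

-- The name refers to the Klein bottle, on which the bundle is a quadrangular grid, as the twist
-- reverses the fibre.
module Klein {S T : ℕ} (2≤S : 2 ≤ S) (2≤T : 2 ≤ T) (φ : Fin (suc T) → Fin (suc T))
             (refl-φ : IsReflection (suc T) φ) where

  open Embed 2≤S 2≤T φ (reflection-injective refl-φ)

  c : ℕ
  c = toℕ (proj₁ refl-φ)

  next→arc : ∀ {u v} → Next u v → BundleArc (suc S) (suc T) φ u v
  next→arc {i , j} {_ , j'} (inj₁ (refl , inj₁ e))       = fiber i j j' e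
  next→arc {i , j} {_ , j'} (inj₁ (refl , inj₂ (e , f))) = fiberWrap i j j' e f
  next→arc {i , j} {i' , _} (inj₂ (inj₁ (e , refl)))     = base i i' j e
  next→arc {i , j} {i' , _} (inj₂ (inj₂ (e , f , refl))) = twist i i' j e f

  φ-involutive : ∀ j → φ (φ j) ≡ j
  φ-involutive j = Fin.toℕ-injective (rotate-injective (toℕ (φ j)) (Fin.toℕ≤pred[n] _) (Fin.toℕ≤pred[n] j) (begin
    (toℕ (φ (φ j)) + toℕ (φ j)) % suc T  ≡⟨ cong (_% suc T) (+-comm (toℕ (φ (φ j))) _) ⟩
    (toℕ (φ j) + toℕ (φ (φ j))) % suc T  ≡⟨ reflection-residue refl-φ (φ j) ⟩
    c                                    ≡⟨ reflection-residue refl-φ j ⟨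
    (toℕ j + toℕ (φ j)) % suc T          ∎))
    where open ≡-Reasoning

  sucF : ∀ j → ∃ λ j' → NextF j j'
  sucF j with toℕ j ≟ T
  ... | yes e = Fin.zero , inj₂ (e , refl)
  ... | no ne = Fin.fromℕ< lt , inj₁ (Fin.toℕ-fromℕ< lt)
    where lt = s≤s (≤∧≢⇒< (Fin.toℕ≤pred[n] j) ne)

  predF : ∀ j → ∃ λ j' → NextF j' j
  predF Fin.zero    = Fin.fromℕ T , inj₂ (Fin.toℕ-fromℕ T , refl)
  predF (Fin.suc j) = Fin.inject₁ j , inj₁ (cong suc (sym (Fin.toℕ-inject₁ j)))

  sucB : ∀ u → ∃ λ v → NextB u v
  sucB (i , j) with toℕ i ≟ S
  ... | yes e = (Fin.zero , φ j) , inj₂ (e , refl , refl)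
  ... | no ne = (Fin.fromℕ< lt , j) , inj₁ (Fin.toℕ-fromℕ< lt , refl)
    where lt = s≤s (≤∧≢⇒< (Fin.toℕ≤pred[n] i) ne)

  predB : ∀ u → ∃ λ v → NextB v u
  predB (Fin.zero , j)  = (Fin.fromℕ S , φ j) , inj₂ (Fin.toℕ-fromℕ S , refl , sym (φ-involutive j))
  predB (Fin.suc i , j) = (Fin.inject₁ i , j) , inj₁ (cong suc (sym (Fin.toℕ-inject₁ i)) , refl)

  neighbour : V → Fin 4 → V
  neighbour (i , j) 0F = i , proj₁ (sucF j)
  neighbour (i , j) 1F = i , proj₁ (predF j)
  neighbour u       2F = proj₁ (sucB u)
  neighbour u       3F = proj₁ (predB u)

  out-F : ∀ u → Next u (neighbour u 0F)
  out-F (i , j) = inj₁ (refl , proj₂ (sucF j))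
  in-F : ∀ u → Next (neighbour u 1F) u
  in-F (i , j) = inj₁ (refl , proj₂ (predF j))
  out-B : ∀ u → Next u (neighbour u 2F)
  out-B u = inj₂ (proj₂ (sucB u))
  in-B : ∀ u → Next (neighbour u 3F) u
  in-B u = inj₂ (proj₂ (predB u))

  neighbour-adj : ∀ u k → Adj u (neighbour u k)
  neighbour-adj u 0F = inj₁ (next→arc (out-F u))
  neighbour-adj u 1F = inj₂ (next→arc (in-F u))
  neighbour-adj u 2F = inj₁ (next→arc (out-B u))
  neighbour-adj u 3F = inj₂ (next→arc (in-B u))

  neighbour-injective : ∀ u → Injective _≡_ _≡_ (neighbour u)
  neighbour-injective u {k} {l} e = go k l e
    where
    opposite : ∀ {v w} → Next u v → Next w u → v ≢ w
    opposite x y refl = next-asym x y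
    go : ∀ k l → neighbour u k ≡ neighbour u l → k ≡ l
    go 0F 0F _ = refl
    go 1F 1F _ = refl
    go 2F 2F _ = refl
    go 3F 3F _ = refl
    go 0F 1F e = contradiction e (opposite (out-F u) (in-F u))
    go 1F 0F e = contradiction (sym e) (opposite (out-F u) (in-F u))
    go 0F 3F e = contradiction e (opposite (out-F u) (in-B u))
    go 3F 0F e = contradiction (sym e) (opposite (out-F u) (in-B u))
    go 2F 1F e = contradiction e (opposite (out-B u) (in-F u))
    go 1F 2F e = contradiction (sym e) (opposite (out-B u) (in-F u))
    go 2F 3F e = contradiction e (opposite (out-B u) (in-B u))
    go 3F 2F e = contradiction (sym e) (opposite (out-B u) (in-B u))
    go 0F 2F e = contradiction (sym (cong proj₁ e)) (NextB-moves (proj₂ (sucB u)))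
    go 2F 0F e = contradiction (cong proj₁ e) (NextB-moves (proj₂ (sucB u)))
    go 1F 3F e = contradiction (cong proj₁ e) (NextB-moves (proj₂ (predB u)))
    go 3F 1F e = contradiction (sym (cong proj₁ e)) (NextB-moves (proj₂ (predB u)))

  adj-irrefl : ∀ {u} → ¬ Adj u u
  adj-irrefl (inj₁ a) = next-asym (arc→next a) (arc→next a)
  adj-irrefl (inj₂ a) = next-asym (arc→next a) (arc→next a)

  open Regular {V} {Adj} (≡-dec Fin._≟_ Fin._≟_) swap adj-irrefl neighbour neighbour-adj neighbour-injective

  four≤pages : ∀ {m} → MatchingBookEmbedding V Adj m → 4 ≤ m
  four≤pages E = degree≤pages E (Fin.zero , Fin.zero)

  four-pages-bipartite : MatchingBookEmbedding V Adj 4 → Bipartite V Adj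
  four-pages-bipartite = bipartite (↔-sym Fin.*↔×)

  φ-zero : toℕ (φ Fin.zero) ≡ c
  φ-zero with proj₂ refl-φ Fin.zero
  ... | inj₁ e = trans (sym (+-identityʳ _)) e
  ... | inj₂ e = contradiction (Fin.toℕ<n (φ Fin.zero))
                   (≤⇒≯ (≤-trans (m≤n+m (suc T) c) (≤-reflexive (trans (sym e) (+-identityʳ _)))))

  -- `S` and `T` are one less than the lengths, so the two values are `true` when `t` and `s + c`
  -- are even.
  Even : Set
  Even = odd T ≡ true × (odd S xor odd c) ≡ true

  -- Two closed walks must have even length: fibre 0, of length `suc T`, and the walk up column 0,
  -- over the twist to `(0 , c)` and back along fibre 0, of length `suc S + c`.
  bipartite⇒even : Bipartite V Adj → Even
  bipartite⇒even (f , proper) = T-odd , xor-moves {f00} λ e → proper (Fin.fromℕ S , Fin.zero) (Fin.zero , φ Fin.zero)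
      (inj₁ (twist _ _ _ (Fin.toℕ-fromℕ S) refl)) (begin
      f (Fin.fromℕ S , Fin.zero)       ≡⟨ column (Fin.fromℕ S) ⟩
      f00 xor odd (toℕ (Fin.fromℕ S))  ≡⟨ cong (λ x → f00 xor odd x) (Fin.toℕ-fromℕ S) ⟩
      f00 xor odd S                    ≡⟨ cong (_xor odd S) e ⟩
      (f00 xor (odd S xor odd c)) xor odd S ≡⟨ cancel f00 (odd S) (odd c) ⟩
      f00 xor odd c                    ≡⟨ cong (λ x → f00 xor odd x) φ-zero ⟨
      f00 xor odd (toℕ (φ Fin.zero))   ≡⟨ row (φ Fin.zero) ⟨
      f (Fin.zero , φ Fin.zero)        ∎)
    where
    open ≡-Reasoning
    f00 = f (Fin.zero , Fin.zero)
    row : ∀ j → f (Fin.zero , j) ≡ f00 xor odd (toℕ j)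
    row = alternating (λ j → f (Fin.zero , j)) λ j j' e → proper _ _ (inj₁ (fiber _ j j' e))
    column : ∀ i → f (i , Fin.zero) ≡ f00 xor odd (toℕ i)
    column = alternating (λ i → f (i , Fin.zero)) λ i i' e → proper _ _ (inj₁ (base i i' _ e))
    T-odd : odd T ≡ true
    T-odd = xor-moves {f00} λ e → proper (Fin.zero , Fin.fromℕ T) (Fin.zero , Fin.zero)
      (inj₁ (fiberWrap _ _ _ (Fin.toℕ-fromℕ T) refl))
      (trans (row (Fin.fromℕ T)) (trans (cong (λ x → f00 xor odd x) (Fin.toℕ-fromℕ T)) (sym e)))
    cancel : ∀ a b c → (a xor (b xor c)) xor b ≡ a xor c
    cancel false false c = xor-identityʳ c
    cancel false true  false = refl
    cancel false true  true  = refl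
    cancel true  false c = xor-identityʳ (not c)
    cancel true  true  false = refl
    cancel true  true  true  = refl

  -- The chessboard colouring works: since `suc T` is even, reduction modulo it keeps parities, so
  -- the twist changes the parity of the second coordinate by that of `c` and that of the first by
  -- that of `S`.
  even⇒bipartite : Even → Bipartite V Adj
  even⇒bipartite (T-odd , Sc) = shade , λ { u v (inj₁ a) → flips a ; u v (inj₂ a) → ≢-sym (flips a) }
    where
    shade : V → Bool
    shade (i , j) = odd (toℕ i) xor odd (toℕ j)
    clash : ∀ x {y z} → y ≢ z → x xor y ≢ x xor z
    clash false ne = ne
    clash true  ne = ne ∘ not-injective
    half : ∀ j → odd (toℕ (φ j)) xor odd (toℕ j) ≡ odd c
    half j with proj₂ refl-φ j
    ... | inj₁ e = trans (sym (odd-+ (toℕ (φ j)) (toℕ j))) (cong odd e)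
    ... | inj₂ e = begin
      odd (toℕ (φ j)) xor odd (toℕ j)  ≡⟨ odd-+ (toℕ (φ j)) (toℕ j) ⟨
      odd (toℕ (φ j) + toℕ j)          ≡⟨ cong odd e ⟩
      odd (c + suc T)                  ≡⟨ odd-+ c (suc T) ⟩
      odd c xor not (odd T)            ≡⟨ cong (λ x → odd c xor not x) T-odd ⟩
      odd c xor false                  ≡⟨ xor-identityʳ (odd c) ⟩
      odd c                            ∎
      where open ≡-Reasoning
    solve : ∀ s x y c → y xor x ≡ c → s xor c ≡ true → s xor x ≢ y
    solve false false false _ refl ()
    solve false false true  _ refl _ ()
    solve false true  false _ refl _ ()
    solve false true  true  _ refl ()
    solve true  false false _ refl _ ()
    solve true  false true  _ refl ()
    solve true  true  false _ refl ()
    solve true  true  true  _ refl _ ()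
    flips : ∀ {u v} → BundleArc (suc S) (suc T) φ u v → shade u ≢ shade v
    flips (fiber i j j' e)       = clash (odd (toℕ i)) λ p → same-parity-suc (toℕ j) (trans p (cong odd e))
    flips (fiberWrap i j j' e f) = clash (odd (toℕ i)) λ p →
      contradiction (trans (sym T-odd) (trans (cong odd (sym e)) (trans p (cong odd f)))) λ ()
    flips (base i i' j e) p      = same-parity-suc (toℕ i) (trans (cancelʳ _ _ (odd (toℕ j)) p) (cong odd e))
      where
      cancelʳ : ∀ x y z → x xor z ≡ y xor z → x ≡ y
      cancelʳ x y false p = trans (sym (xor-identityʳ x)) (trans p (xor-identityʳ y))
      cancelʳ false false true p = refl
      cancelʳ true true true p = refl
    flips (twist i i' j e f) p =
      solve (odd S) (odd (toℕ j)) (odd (toℕ (φ j))) (odd c) (half j) Sc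
        (trans (cong (λ k → odd k xor odd (toℕ j)) (sym e)) (trans p (cong (λ k → odd k xor odd (toℕ (φ j))) f)))

  laid-out : ∀ {m c₀ G} → Layout G S m → Unrolling T c₀ G → (∃ λ k → (c + (k + k)) % suc T ≡ c₀) →
             MatchingBookEmbedding V Adj m
  laid-out L U (k , e) = embedding L (coordinates refl-φ k e U)

  doubled : odd T ≡ true → ∃ λ n → T ≡ n + suc n
  doubled e with odd-halve (suc T) (cong not e)
  ... | suc n , p = n , suc-injective p

  -- For even `suc T` rotations preserve the parity of `c`: an odd `c` can be moved to `T` and an
  -- even one to `0`. `Even` makes `c` odd exactly when `S` is even, which is how the two layouts
  -- are matched to their normal forms.
  four-pages : Even → MatchingBookEmbedding V Adj 4
  four-pages (T-odd , Sc) = go (odd S) refl (odd c) refl Sc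
    where
    go : ∀ x → odd S ≡ x → ∀ y → odd c ≡ y → x xor y ≡ true → MatchingBookEmbedding V Adj 4
    go false s true y _ = laid-out (FourPageOdd.layout S T 2≤S 2≤T s T-odd)
      (FourPageOdd.unrolling S T 2≤S 2≤T s T-odd) (normalise-T c T (inj₁ y))
    go true s false y _ with doubled T-odd
    ... | zero  , e = contradiction (subst (2 ≤_) e 2≤T) λ { (s≤s ()) }
    ... | suc n , e = laid-out (FourPageEven.layout S n s) (subst (λ T → Unrolling T 0 _) (sym e) (FourPageEven.unrolling S n s))
                        (normalise-0 c T (inj₁ y))

  -- For odd `suc T` every `c` can be moved to either normal form, and the parity of `S` decides
  -- which one is wanted. For even `suc T`, failure of `Even` gives `c` the parity of `S`, which
  -- leads to the same choice.
  five-pages : ¬ Even → MatchingBookEmbedding V Adj 5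
  five-pages ¬even = go (odd S) refl (odd T) refl
    where
    evenT : odd T ≡ true → (odd S xor odd c) ≡ false
    evenT e = ¬-not λ p → ¬even (e , p)
    c-parity : ∀ x → odd S ≡ x → odd T ≡ true → odd c ≡ x
    c-parity false s t = subst (λ x → x xor odd c ≡ false) s (evenT t)
    c-parity true  s t = not-injective (subst (λ x → x xor odd c ≡ false) s (evenT t))
    go : ∀ x → odd S ≡ x → ∀ y → odd T ≡ y → MatchingBookEmbedding V Adj 5
    go false s y t = laid-out (FivePageOdd.layout S T 2≤S 2≤T s) (FivePageOdd.unrolling S T 2≤S 2≤T s) (normalise-0 c T (c-or-T y t))
      where
      c-or-T : ∀ y → odd T ≡ y → odd c ≡ false ⊎ odd T ≡ false
      c-or-T true  t = inj₁ (c-parity false s t)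
      c-or-T false t = inj₂ t
    go true s true t with doubled t
    ... | n , e = laid-out (FivePageEven.layout S n false s) (subst (λ T → Unrolling T T _) (sym e) (FivePageEven.unrolling S n false s))
                    (normalise-T c T (inj₁ (c-parity true s t)))
    go true s false t with odd-halve T t
    ... | zero  , e = contradiction (subst (2 ≤_) e 2≤T) λ ()
    ... | suc n , e = laid-out (FivePageEven.layout S n true s) (subst (λ T → Unrolling T T _) (sym e) (FivePageEven.unrolling S n true s))
                        (normalise-T c T (inj₂ t))

  thickness-bipartite : Bipartite V Adj → HasMBT V Adj 4
  thickness-bipartite b = four-pages (bipartite⇒even b) , λ m m<4 E → <⇒≱ m<4 (four≤pages E)

  thickness-nonbipartite : ¬ Bipartite V Adj → HasMBT V Adj 5
  thickness-nonbipartite ¬b = five-pages (¬b ∘ even⇒bipartite) , λ m m<5 E →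
    ¬b (four-pages-bipartite (subst (MatchingBookEmbedding V Adj) (≤-antisym (s≤s⁻¹ m<5) (four≤pages E)) E))

theorem4p1 : (s t : ℕ) → 3 ≤ s → 3 ≤ t → (φ : Fin t → Fin t) → IsReflection t φ →
    (Bipartite (Fin s × Fin t) (BundleAdj s t φ) → HasMBT (Fin s × Fin t) (BundleAdj s t φ) 4)
    × (¬ Bipartite (Fin s × Fin t) (BundleAdj s t φ) → HasMBT (Fin s × Fin t) (BundleAdj s t φ) 5)
theorem4p1 (suc S) (suc T) (s≤s 2≤S) (s≤s 2≤T) φ r = thickness-bipartite , thickness-nonbipartite
  where open Klein 2≤S 2≤T φ r
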